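{- $\tau_E(\mathcal{D}_n) = \frac{1}{2}\binom{n-1}{2} + \Theta(\log n)$ and $\tau_E(\mathcal{T}_n) = \frac{1}{2}\binom{n-1}{2} + \Theta(\log n)$; that is, there exist constants $c_1, c_2 > 0$ such that for all sufficiently large $n$, both $\tau_E(\mathcal{D}_n)$ and $\tau_E(\mathcal{T}_n)$ lie between $\frac{1}{2}\binom{n-1}{2} + c_1 \log n$ and $\frac{1}{2}\binom{n-1}{2} + c_2 \log n$.
   Context: Let $\mathcal{F}$ be a hypergraph whose vertex set is $E(K_n)$, the edge set of the complete graph on $n$ vertices; its hyperedges are called losing sets. In the unbiased Avoider-Enforcer game on $\mathcal{F}$, two players, Avoider and Enforcer, alternately claim previously unclaimed edges of $K_n$, one edge per turn, with Avoider going first, until all edges are claimed. Enforcer wins if the set of edges claimed by Avoider contains some hyperedge of $\mathcal{F}$; otherwise Avoider wins. $\tau_E(\mathcal{F})$ denotes the smallest integer $t$ such that Enforcer has a strategy guaranteeing that, whatever Avoider does, Avoider's graph contains a hyperedge of $\mathcal{F}$ after at most $t$ moves (rounds); $\tau_E(\mathcal{F})=\infty$ if Avoider wins. $\mathcal{D}_n$ is the hypergraph on $E(K_n)$ whose hyperedges are the edge sets of all graphs on the vertex set of $K_n$ with positive minimum degree (no isolated vertex), and $\mathcal{T}_n$ is the hypergraph whose hyperedges are the edge sets of all connected spanning graphs on the vertex set of $K_n$. Here $\log$ denotes the natural logarithm. -}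

module Defs where

open import Data.Nat using (ℕ; zero; suc; _+_; _*_; _∸_; _^_; _≤_; _<ᵇ_)
open import Data.Nat.Combinatorics using (_C_)
open import Data.Fin using (Fin; toℕ)
open import Data.List using (List; []; _∷_; concatMap; allFin)
open import Data.List.Membership.Propositional using (_∈_)
open import Data.List.Relation.Binary.Subset.Propositional using (_⊆_)
open import Data.List.Relation.Unary.Any using (_─_)
open import Data.Product using (Σ; ∃; ∃-syntax; _×_; _,_)
open import Data.Sum using (_⊎_)
open import Data.Bool using (if_then_else_)

-- An edge of K_n is an ordered pair (i , j); the board consists of the
-- pairs with i < j (each edge of K_n appears exactly once).
Edge : ℕ → Set
Edge n = Fin n × Fin n

allEdges : (n : ℕ) → List (Edge n)
allEdges n = concatMap (λ i → concatMap (λ j →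
  if toℕ i <ᵇ toℕ j then (i , j) ∷ [] else []) (allFin n)) (allFin n)

-- A hypergraph on E(K_n): a predicate on edge sets (given as lists).
Hypergraph : ℕ → Set₁
Hypergraph n = List (Edge n) → Set

Adj : {n : ℕ} → List (Edge n) → Fin n → Fin n → Set
Adj H u v = ((u , v) ∈ H) ⊎ ((v , u) ∈ H)

data Reach {n : ℕ} (H : List (Edge n)) : Fin n → Fin n → Set where
  here : ∀ {u} → Reach H u u
  step : ∀ {u v w} → Adj H u v → Reach H v w → Reach H u w

𝒟 : (n : ℕ) → Hypergraph n
𝒟 n H = ∀ (v : Fin n) → ∃[ u ] Adj H v u

𝒯 : (n : ℕ) → Hypergraph n
𝒯 n H = ∀ (u v : Fin n) → Reach H u v

Lost : {n : ℕ} → Hypergraph n → List (Edge n) → Set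
Lost F A = ∃[ H ] (H ⊆ A × F H)

-- EnforcerWithin F t A U : with Avoider's current edges A, unclaimed edges U,
-- and Avoider to move, Enforcer can guarantee that Avoider's graph contains
-- a hyperedge of F within at most t further rounds.
EnforcerWithin : {n : ℕ} → Hypergraph n → ℕ → List (Edge n) → List (Edge n) → Set
EnforcerWithin F zero A U = Lost F A
EnforcerWithin F (suc t) A U =
  Lost F A ⊎
  ((∃[ e ] (e ∈ U)) ×
   (∀ e (p : e ∈ U) →
      Lost F (e ∷ A) ⊎
      (∃[ e′ ] Σ (e′ ∈ (U ─ p)) λ q →
          EnforcerWithin F t (e ∷ A) ((U ─ p) ─ q))))

IsTauE : (n : ℕ) → Hypergraph n → ℕ → Set
IsTauE n F t = EnforcerWithin F t [] (allEdges n)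
             × (∀ s → EnforcerWithin F s [] (allEdges n) → t ≤ s)

-- Lower bound  (1/2) C(n-1,2) + (p/q) log₂ n ≤ t, written exactly in ℕ:
--   C(n-1,2) ≤ 2t  and  n^(2p) ≤ 2^(q (2t - C(n-1,2)))
LowerBound : ℕ → ℕ → ℕ → ℕ → Set
LowerBound n p q t = ((n ∸ 1) C 2 ≤ 2 * t) × (n ^ (2 * p) ≤ 2 ^ (q * (2 * t ∸ (n ∸ 1) C 2)))

-- Upper bound  t ≤ (1/2) C(n-1,2) + (p/q) log₂ n, written exactly in ℕ:
--   2^(q (2t ∸ C(n-1,2))) ≤ n^(2p)
UpperBound : ℕ → ℕ → ℕ → ℕ → Set
UpperBound n p q t = 2 ^ (q * (2 * t ∸ (n ∸ 1) C 2)) ≤ n ^ (2 * p)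

TauBetween : (n : ℕ) → Hypergraph n → ℕ → ℕ → ℕ → ℕ → Set
TauBetween n F p₁ q₁ p₂ q₂ =
  ∃[ t ] (IsTauE n F t × LowerBound n p₁ q₁ t × UpperBound n p₂ q₂ t)

{-# OPTIONS --safe #-}

-- Only the partition of the board into claimed and free edges matters, never who claimed a claimed edge: an edge
-- at a vertex isolated in Avoider's graph, or between two of its components, is Enforcer's or free anyway.
--
-- Lower bound. Avoider keeps a set S of vertices and plays inside S as long as he can. When S is exhausted after r
-- rounds, the number D of claimed edges not inside S equals 2r - C(|S|,2); this fixes the parity of D, so Enforcer
-- loses an edge outside S in at least every second extension of S, unless the claimed degrees into S go up.
-- Avoider extends S by the vertex of least claimed degree into S, which does not decrease the average of D over the
-- m vertices outside S, whereas an edge that Enforcer is forced to add increases it by 1/m. Summing 1/m over the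
-- extensions gives a last vertex of claimed degree of order log n.
--
-- Upper bound. Enforcer plays inside a component of Avoider's graph if possible, else between non-isolated
-- vertices, else from an isolated vertex of least degree to a non-isolated one. In the last case Avoider must next
-- use up an isolated vertex, so the sum of 2^deg over the isolated vertices hardly exceeds n, and their degrees are
-- at most 1 + log₂ n. In the last two cases Avoider's next move, if not already forced to, merges two components, so
-- at most n claimed edges join different components; a cut with two vertices on each side has more edges than that.
module Submission where

open import Defs
import Algebra.Properties.CommutativeMonoid.Sum as Sum
open import Data.Bool using (Bool; true; false; not; _∧_; _∨_; if_then_else_; T)
import Data.Bool.Properties as 𝔹
open import Data.Fin using (Fin; zero; suc; toℕ)
open import Data.Fin.Properties using (_≟_; any?; all?)
open import Data.List using (List; []; _∷_; _++_; map; concatMap; allFin; tabulate; length; filter)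
open import Data.List.Membership.DecPropositional as DecMembership using ()
open import Data.List.Membership.Propositional using (_∈_)
open import Data.List.Membership.Propositional.Properties using (∈-filter⁺; ∈-allFin)
open import Data.List.Properties using (filter-notAll; length-tabulate)
open import Data.List.Relation.Binary.Subset.Propositional using (_⊆_)
open import Data.List.Relation.Unary.Any as Any using (here; there; _─_)
open import Data.Nat using (ℕ; zero; suc; pred; _+_; _*_; _∸_; _^_; _≤_; _<_; _<ᵇ_; z≤n; s≤s; s≤s⁻¹; _≤?_; NonZero; >-nonZero)
open import Data.Nat.Combinatorics using (nCk+nC[k+1]≡[n+1]C[k+1]; nC1≡n) renaming (_C_ to _choose_)
open import Data.Nat.DivMod using (_/_; _%_; m≡m%n+[m/n]*n; m%n<n)
open import Data.Nat.ListAction using () renaming (sum to sumᴸ)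
open import Data.Nat.Properties hiding (_≟_)
open import Data.Nat.Tactic.RingSolver using (solve-∀)
open import Data.Product using (∃; ∃-syntax; Σ; _×_; _,_; proj₁; proj₂)
open import Data.Product.Properties using (≡-dec)
open import Data.Sum using (_⊎_; inj₁; inj₂; [_,_]′) renaming (map to ⊎-map)
open import Function using (_∘_; id)
open import Relation.Binary.PropositionalEquality
  using (_≡_; _≢_; refl; sym; trans; cong; cong₂; subst; module ≡-Reasoning)
open import Relation.Nullary using (¬_; Dec; yes; no; does; contradiction)
open import Relation.Nullary.Decidable using (_×-dec_; _⊎-dec_; ¬?; map′)

open Sum +-0-commutativeMonoid using (sum; sum-cong-≗; ∑-distrib-+)

-- Sums and weights

⟦_⟧ : Bool → ℕ
⟦ true ⟧ = 1
⟦ false ⟧ = 0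

⟦⟧≤1 : ∀ b → ⟦ b ⟧ ≤ 1
⟦⟧≤1 true = ≤-refl
⟦⟧≤1 false = z≤n

∑-mono : ∀ {n} {f g : Fin n → ℕ} → (∀ i → f i ≤ g i) → sum f ≤ sum g
∑-mono {zero} le = z≤n
∑-mono {suc n} le = +-mono-≤ (le zero) (∑-mono (le ∘ suc))

∑-mono-gap : ∀ {n} {f g : Fin n → ℕ} i {c} → (∀ j → f j ≤ g j) → c + f i ≤ g i → c + sum f ≤ sum g
∑-mono-gap {suc n} {f} zero {c} le gap =
  ≤-trans (≤-reflexive (sym (+-assoc c (f zero) _))) (+-mono-≤ gap (∑-mono (le ∘ suc)))
∑-mono-gap {suc n} {f} {g} (suc i) {c} le gap = begin
  c + (f zero + sum (f ∘ suc)) ≡⟨ swap c (f zero) _ ⟩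
  f zero + (c + sum (f ∘ suc)) ≤⟨ +-mono-≤ (le zero) (∑-mono-gap i (le ∘ suc) gap) ⟩
  g zero + sum (g ∘ suc) ∎
  where
  open ≤-Reasoning
  swap : ∀ a b c → a + (b + c) ≡ b + (a + c)
  swap = solve-∀

∑-mono-bump : ∀ {n} {f g : Fin n → ℕ} i {c} → (∀ j → j ≢ i → f j ≤ g j) → f i ≤ c + g i → sum f ≤ c + sum g
∑-mono-bump {suc n} {f} {g} zero {c} le bump =
  ≤-trans (+-mono-≤ bump (∑-mono (λ j → le (suc j) λ ()))) (≤-reflexive (+-assoc c (g zero) _))
∑-mono-bump {suc n} {f} {g} (suc i) {c} le bump = begin
  f zero + sum (f ∘ suc) ≤⟨ +-mono-≤ (le zero λ ()) (∑-mono-bump i (λ j j≢i → le (suc j) λ { refl → j≢i refl }) bump) ⟩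
  g zero + (c + sum (g ∘ suc)) ≡⟨ swap (g zero) c _ ⟩
  c + (g zero + sum (g ∘ suc)) ∎
  where
  open ≤-Reasoning
  swap : ∀ a b c → a + (b + c) ≡ b + (a + c)
  swap = solve-∀

term≤∑ : ∀ {n} (f : Fin n → ℕ) i → f i ≤ sum f
term≤∑ f zero = m≤m+n _ _
term≤∑ f (suc i) = ≤-trans (term≤∑ (f ∘ suc) i) (m≤n+m _ _)

∑-zero : ∀ n → sum {n} (λ _ → 0) ≡ 0
∑-zero zero = refl
∑-zero (suc n) = ∑-zero n

∑-one : ∀ n → sum {n} (λ _ → 1) ≡ n
∑-one zero = refl
∑-one (suc n) = cong suc (∑-one n)

infix 7 _==_
_==_ : ∀ {n} → Fin n → Fin n → Bool
i == j = does (i ≟ j)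

==-refl : ∀ {n} (i : Fin n) → i == i ≡ true
==-refl i with i ≟ i
... | yes _ = refl
... | no i≢i = contradiction refl i≢i

==-sound : ∀ {n} {i j : Fin n} → i == j ≡ true → i ≡ j
==-sound {i = i} {j} eq with i ≟ j
... | yes p = p

==-≢ : ∀ {n} {i j : Fin n} → i ≢ j → i == j ≡ false
==-≢ {i = i} {j} ne with i ≟ j
... | yes p = contradiction p ne
... | no _ = refl

∑-== : ∀ {n} (j : Fin n) → sum (λ i → ⟦ i == j ⟧) ≤ 1
∑-== {n} j = ≤-trans (∑-mono-bump {g = λ _ → 0} j {1} (λ i i≢j → ≤-reflexive (cong ⟦_⟧ (==-≢ i≢j))) (⟦⟧≤1 _))
  (≤-reflexive (cong suc (∑-zero n)))

size : ∀ {n} → (Fin n → Bool) → ℕ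
size S = sum (λ i → ⟦ S i ⟧)

∁ : ∀ {n} → (Fin n → Bool) → Fin n → Bool
∁ S i = not (S i)

size-∁ : ∀ {n} (S : Fin n → Bool) → size (∁ S) + size S ≡ n
size-∁ {n} S = begin
  size (∁ S) + size S                          ≡⟨ ∑-distrib-+ (λ i → ⟦ not (S i) ⟧) (λ i → ⟦ S i ⟧) ⟨
  sum (λ i → ⟦ not (S i) ⟧ + ⟦ S i ⟧)          ≡⟨ sum-cong-≗ (λ i → lem (S i)) ⟩
  sum {n} (λ _ → 1)                            ≡⟨ ∑-one n ⟩
  n                                            ∎
  where
  open ≡-Reasoning
  lem : ∀ b → ⟦ not b ⟧ + ⟦ b ⟧ ≡ 1
  lem true = refl
  lem false = refl

infixl 6 _∪_
_∪_ : ∀ {n} → (Fin n → Bool) → Fin n → Fin n → Bool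
(S ∪ x) i = S i ∨ i == x

size-∪ : ∀ {n} (S : Fin n → Bool) x → S x ≡ false → size (S ∪ x) ≡ suc (size S)
size-∪ {suc n} S zero Sx rewrite Sx = cong suc (sum-cong-≗ (λ i → cong ⟦_⟧ (lem (S (suc i)))))
  where
  lem : ∀ b → b ∨ false ≡ b
  lem true = refl
  lem false = refl
size-∪ {suc n} S (suc x) Sx = begin
  ⟦ S zero ∨ false ⟧ + sum (λ i → ⟦ S (suc i) ∨ suc i == suc x ⟧)
    ≡⟨ cong₂ _+_ (lem (S zero)) (trans (sum-cong-≗ λ i → cong (λ b → ⟦ S (suc i) ∨ b ⟧) (lem′ i)) (size-∪ (S ∘ suc) x Sx)) ⟩
  ⟦ S zero ⟧ + suc (size (S ∘ suc))
    ≡⟨ solve+ ⟦ S zero ⟧ _ ⟩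
  suc (⟦ S zero ⟧ + size (S ∘ suc)) ∎
  where
  open ≡-Reasoning
  lem : ∀ b → ⟦ b ∨ false ⟧ ≡ ⟦ b ⟧
  lem true = refl
  lem false = refl
  lem′ : ∀ i → suc i == suc x ≡ i == x
  lem′ i with i ≟ x
  ... | yes _ = refl
  ... | no _ = refl
  solve+ : ∀ a b → a + suc b ≡ suc (a + b)
  solve+ = solve-∀

size-pos : ∀ {n} (S : Fin n → Bool) → 0 < size S → ∃[ x ] S x ≡ true
size-pos {suc n} S pos with S zero in eq
... | true = zero , eq
... | false with size-pos (S ∘ suc) pos
... | x , Sx = suc x , Sx

size-mono : ∀ {n} {S S′ : Fin n → Bool} → (∀ i → S i ≡ true → S′ i ≡ true) → size S ≤ size S′
size-mono {S = S} {S′} sub = ∑-mono λ i → lem (S i) (S′ i) (sub i)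
  where
  lem : ∀ b b′ → (b ≡ true → b′ ≡ true) → ⟦ b ⟧ ≤ ⟦ b′ ⟧
  lem true b′ f rewrite f refl = ≤-refl
  lem false b′ f = z≤n

size*≤∑ : ∀ {n} (S : Fin n → Bool) (f : Fin n → ℕ) c → (∀ i → S i ≡ true → c ≤ f i) →
          size S * c ≤ sum (λ i → ⟦ S i ⟧ * f i)
size*≤∑ {zero} S f c le = z≤n
size*≤∑ {suc n} S f c le with S zero in eq
... | true = +-mono-≤ (≤-trans (le zero eq) (≤-reflexive (sym (+-identityʳ _)))) (size*≤∑ (S ∘ suc) (f ∘ suc) c (le ∘ suc))
... | false = size*≤∑ (S ∘ suc) (f ∘ suc) c (le ∘ suc)

argmin : ∀ {n} (S : Fin n → Bool) (f : Fin n → ℕ) x₀ → S x₀ ≡ true →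
         ∃[ x ] (S x ≡ true × (∀ y → S y ≡ true → f x ≤ f y))
argmin {suc n} S f x₀ Sx₀ with size (S ∘ suc) in eq
argmin {suc n} S f zero Sx₀ | zero = zero , Sx₀ , min
  where
  min : ∀ y → S y ≡ true → f zero ≤ f y
  min zero _ = ≤-refl
  min (suc y) Sy with ≤-trans (≤-trans (≤-reflexive (cong ⟦_⟧ (sym Sy))) (term≤∑ (λ i → ⟦ S (suc i) ⟧) y)) (≤-reflexive eq)
  ... | ()
argmin {suc n} S f (suc x) Sx₀ | zero with ≤-trans (≤-trans (≤-reflexive (cong ⟦_⟧ (sym Sx₀))) (term≤∑ (λ i → ⟦ S (suc i) ⟧) x)) (≤-reflexive eq)
... | ()
argmin {suc n} S f x₀ Sx₀ | suc k with size-pos (S ∘ suc) (subst (0 <_) (sym eq) (s≤s z≤n))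
... | x₁ , Sx₁ with argmin (S ∘ suc) (f ∘ suc) x₁ Sx₁
... | x , Sx , min with S zero in eq₀ | ≤-total (f zero) (f (suc x))
... | false | _ = suc x , Sx , λ { zero Sy → contradiction (trans (sym Sy) eq₀) λ () ; (suc y) Sy → min y Sy }
... | true | inj₁ le = zero , eq₀ , λ { zero _ → ≤-refl ; (suc y) Sy → ≤-trans le (min y Sy) }
... | true | inj₂ ge = suc x , Sx , λ { zero _ → ge ; (suc y) Sy → min y Sy }

wt : ∀ {A : Set} → (A → ℕ) → List A → ℕ
wt w L = sumᴸ (map w L)

module _ {A : Set} where

  wt-mono : {w w′ : A → ℕ} → (∀ e → w e ≤ w′ e) → ∀ L → wt w L ≤ wt w′ L
  wt-mono le [] = z≤n
  wt-mono le (e ∷ L) = +-mono-≤ (le e) (wt-mono le L)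

  wt-+ : (w w′ : A → ℕ) → ∀ L → wt (λ e → w e + w′ e) L ≡ wt w L + wt w′ L
  wt-+ w w′ [] = refl
  wt-+ w w′ (e ∷ L) rewrite wt-+ w w′ L = lem (w e) (w′ e) _ _
    where
    lem : ∀ a b c d → a + b + (c + d) ≡ a + c + (b + d)
    lem = solve-∀

  wt-cong : {w w′ : A → ℕ} → (∀ e → w e ≡ w′ e) → ∀ L → wt w L ≡ wt w′ L
  wt-cong eq [] = refl
  wt-cong eq (e ∷ L) = cong₂ _+_ (eq e) (wt-cong eq L)

  wt-++ : (w : A → ℕ) → ∀ L L′ → wt w (L ++ L′) ≡ wt w L + wt w L′
  wt-++ w [] L′ = refl
  wt-++ w (e ∷ L) L′ = trans (cong (w e +_) (wt-++ w L L′)) (sym (+-assoc (w e) _ _))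

  wt-─ : (w : A → ℕ) {e : A} {L : List A} (p : e ∈ L) → w e + wt w (L ─ p) ≡ wt w L
  wt-─ w (here refl) = refl
  wt-─ w {e} {e′ ∷ L} (there p) = trans (lem (w e) (w e′) _) (cong (w e′ +_) (wt-─ w p))
    where
    lem : ∀ a b c → a + (b + c) ≡ b + (a + c)
    lem = solve-∀

  wt-pos : (w : A → ℕ) (L : List A) → 0 < wt w L → ∃[ e ] (e ∈ L × 0 < w e)
  wt-pos w (e ∷ L) pos with w e in eq
  ... | suc k = e , here refl , subst (0 <_) (sym eq) (s≤s z≤n)
  ... | zero with wt-pos w L pos
  ... | e′ , p , q = e′ , there p , q

  wt-zero : (w : A → ℕ) {e : A} {L : List A} → wt w L ≡ 0 → e ∈ L → w e ≡ 0
  wt-zero w {e} {L} eq p = m+n≡0⇒m≡0 (w e) (trans (wt-─ w p) eq)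

  wt-∑ : ∀ {n} (w : Fin n → A → ℕ) L → sum (λ x → wt (w x) L) ≡ wt (λ e → sum (λ x → w x e)) L
  wt-∑ {n} w [] = ∑-zero n
  wt-∑ w (e ∷ L) = trans (∑-distrib-+ (λ x → w x e) (λ x → wt (w x) L)) (cong (sum (λ x → w x e) +_) (wt-∑ w L))

  wt-concatMap : ∀ {B : Set} (w : A → ℕ) (f : B → List A) L → wt w (concatMap f L) ≡ wt (wt w ∘ f) L
  wt-concatMap w f [] = refl
  wt-concatMap w f (b ∷ L) = trans (wt-++ w (f b) (concatMap f L)) (cong (wt w (f b) +_) (wt-concatMap w f L))

wt-tabulate : ∀ {A : Set} {n} (w : A → ℕ) (f : Fin n → A) → wt w (tabulate f) ≡ sum (w ∘ f)
wt-tabulate {n = zero} w f = refl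
wt-tabulate {n = suc n} w f = cong (w (f zero) +_) (wt-tabulate w (f ∘ suc))

pairs : ∀ n → (Fin n → Fin n → ℕ) → ℕ
pairs n w = sum {n} λ i → sum {n} λ j → if toℕ i <ᵇ toℕ j then w i j else 0

wt-allEdges : ∀ {n} (w : Edge n → ℕ) → wt w (allEdges n) ≡ pairs n (λ i j → w (i , j))
wt-allEdges {n} w = begin
  wt w (allEdges n)                                    ≡⟨ wt-concatMap w row (allFin n) ⟩
  wt (wt w ∘ row) (allFin n)                           ≡⟨ wt-tabulate (wt w ∘ row) id ⟩
  sum (wt w ∘ row)                                     ≡⟨ sum-cong-≗ eqRow ⟩
  pairs n (λ i j → w (i , j))                          ∎
  where
  open ≡-Reasoning
  cell : Fin n → Fin n → List (Edge n)
  cell i j = if toℕ i <ᵇ toℕ j then (i , j) ∷ [] else []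
  row : Fin n → List (Edge n)
  row i = concatMap (cell i) (allFin n)
  eqCell : ∀ i j → wt w (cell i j) ≡ (if toℕ i <ᵇ toℕ j then w (i , j) else 0)
  eqCell i j with toℕ i <ᵇ toℕ j
  ... | true = +-identityʳ _
  ... | false = refl
  eqRow : ∀ i → wt w (row i) ≡ sum (λ j → if toℕ i <ᵇ toℕ j then w (i , j) else 0)
  eqRow i = trans (wt-concatMap w (cell i) (allFin n)) (trans (wt-tabulate (wt w ∘ cell i) id) (sum-cong-≗ (eqCell i)))

-- The binomial coefficient C(n,2), in the form in which adding a vertex to a set of size `n` adds
-- `n` by computation.
tri : ℕ → ℕ
tri zero = 0
tri (suc n) = n + tri n

tri≡C2 : ∀ n → n choose 2 ≡ tri n
tri≡C2 zero = refl
tri≡C2 (suc n) = trans (sym (nCk+nC[k+1]≡[n+1]C[k+1] n 1)) (cong₂ _+_ (nC1≡n n) (tri≡C2 n))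

inside : ∀ {n} → (Fin n → Bool) → Edge n → Bool
inside S (i , j) = S i ∧ S j

-- Induction splitting off the vertex `zero`: since `<ᵇ` computes on successors, the column of
-- `zero` vanishes and its row reduces to the first summand.
pairs-inside : ∀ n (S : Fin n → Bool) → pairs n (λ i j → ⟦ S i ∧ S j ⟧) ≡ tri (size S)
pairs-inside zero S = refl
pairs-inside (suc n) S = begin
  sum (λ j → ⟦ S zero ∧ S (suc j) ⟧) + pairs n (λ i j → ⟦ S (suc i) ∧ S (suc j) ⟧)
    ≡⟨ cong (sum (λ j → ⟦ S zero ∧ S (suc j) ⟧) +_) (pairs-inside n (S ∘ suc)) ⟩
  sum (λ j → ⟦ S zero ∧ S (suc j) ⟧) + tri (size (S ∘ suc))
    ≡⟨ lem (S zero) ⟩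
  tri (size S) ∎
  where
  open ≡-Reasoning
  lem : ∀ b → sum (λ j → ⟦ b ∧ S (suc j) ⟧) + tri (size (S ∘ suc)) ≡ tri (⟦ b ⟧ + size (S ∘ suc))
  lem true = refl
  lem false = cong (_+ tri (size (S ∘ suc))) (∑-zero n)

wt-inside : ∀ {n} (S : Fin n → Bool) → wt (⟦_⟧ ∘ inside S) (allEdges n) ≡ tri (size S)
wt-inside {n} S = trans (wt-allEdges (⟦_⟧ ∘ inside S)) (pairs-inside n S)

-- The degree race

Even : ℕ → Set
Even x = ∃[ r ] x ≡ r + r

parity : ℕ → ℕ
parity 0 = 0
parity 1 = 1
parity (suc (suc n)) = parity n

parity-double : ∀ r x → parity (r + r + x) ≡ parity x
parity-double zero x = refl
parity-double (suc r) x rewrite +-comm r (suc r) = parity-double r x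

parity≤1 : ∀ n → parity n ≤ 1
parity≤1 0 = z≤n
parity≤1 1 = ≤-refl
parity≤1 (suc (suc n)) = parity≤1 n

parity-suc : ∀ n → 1 ≤ parity n + parity (suc n)
parity-suc 0 = ≤-refl
parity-suc 1 = ≤-refl
parity-suc (suc (suc n)) = parity-suc n

-- At a stuck position of Avoider there are m + 1 vertices outside the a vertices of S, D claimed edges not inside S,
-- and each outside vertex has claimed degree at least μ into S. The quota holds if Avoider, always extending S by
-- a vertex of degree d < k into S, ends with D ≥ k at a single vertex.
Quota : (k m a D μ : ℕ) → Set
Quota k zero a D μ = k ≤ D
Quota k (suc m) a D μ = ∀ d → μ ≤ d → d < k → (2 + m) * d ≤ D →
  ∀ D′ → D ≤ D′ + d → Even (D′ + tri (suc a)) → Quota k m (suc a) D′ d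

-- The average of D over the outside vertices never drops, because each removed degree is at most
-- the average. An average of at least k therefore survives until one vertex is left.
descend : ∀ k j → 8 * k ≤ j → ∀ m a D μ → suc m * j ≤ 8 * D → Quota k m a D μ
descend k j 8k≤j zero a D μ le = *-cancelˡ-≤ 8 (≤-trans 8k≤j (≤-trans (≤-reflexive (sym (+-identityʳ j))) le))
descend k j 8k≤j (suc m) a D μ le d μ≤d d<k md D′ D≤ ev = descend k j 8k≤j m (suc a) D′ d
  -- Subtraction is avoided: the claim is multiplied by `2 + m`, and `8 * D` is added to both sides
  -- to absorb the removed degree.
  (*-cancelˡ-≤ (2 + m) (+-cancelʳ-≤ (8 * D) _ _ (begin
    (2 + m) * (suc m * j) + 8 * D             ≡⟨ e₁ m j D ⟩
    suc m * ((2 + m) * j) + 8 * D             ≤⟨ +-monoˡ-≤ (8 * D) (*-monoʳ-≤ (suc m) le) ⟩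
    suc m * (8 * D) + 8 * D                   ≡⟨ e₂ m D ⟩
    (2 + m) * (8 * D)                         ≤⟨ *-monoʳ-≤ (2 + m) (*-monoʳ-≤ 8 D≤) ⟩
    (2 + m) * (8 * (D′ + d))                  ≡⟨ e₃ m D′ d ⟩
    (2 + m) * (8 * D′) + 8 * ((2 + m) * d)    ≤⟨ +-monoʳ-≤ ((2 + m) * (8 * D′)) (*-monoʳ-≤ 8 md) ⟩
    (2 + m) * (8 * D′) + 8 * D                ∎)))
  where
  open ≤-Reasoning
  e₁ : ∀ m j D → (2 + m) * (suc m * j) + 8 * D ≡ suc m * ((2 + m) * j) + 8 * D
  e₁ = solve-∀
  e₂ : ∀ m D → suc m * (8 * D) + 8 * D ≡ (2 + m) * (8 * D)
  e₂ = solve-∀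
  e₃ : ∀ m D d → (2 + m) * (8 * (D + d)) ≡ (2 + m) * (8 * D) + 8 * ((2 + m) * d)
  e₃ = solve-∀

-- If `D` equals `D′ + d`, adding the two evenness hypotheses makes `a + d` even. So an odd `a + d`
-- costs Enforcer one more edge outside the set.
forced : ∀ a D d D′ → Even (D + tri a) → Even (D′ + tri (suc a)) → D ≤ D′ + d → D + parity (a + d) ≤ D′ + d
forced a D d D′ (r , eq) (r′ , eq′) D≤ with m≤n⇒m<n∨m≡n D≤
... | inj₁ D< = ≤-trans (+-monoʳ-≤ D (parity≤1 (a + d))) (≤-trans (≤-reflexive (+-comm D 1)) D<)
... | inj₂ refl = ≤-reflexive (trans (cong (D′ + d +_) parity≡0) (+-identityʳ _))
  where
  e : ∀ D′ a t d → D′ + (a + t) + (D′ + d + t) ≡ (D′ + t) + (D′ + t) + (a + d)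
  e = solve-∀
  f : ∀ r r′ → r′ + r′ + (r + r) ≡ (r + r′) + (r + r′) + 0
  f = solve-∀
  parity≡0 : parity (a + d) ≡ 0
  parity≡0 = begin
    parity (a + d)                                             ≡⟨ parity-double (D′ + tri a) (a + d) ⟨
    parity ((D′ + tri a) + (D′ + tri a) + (a + d))             ≡⟨ cong parity (e D′ a (tri a) d) ⟨
    parity (D′ + (a + tri a) + (D′ + d + tri a))               ≡⟨ cong parity (cong₂ _+_ eq′ eq) ⟩
    parity (r′ + r′ + (r + r))                                 ≡⟨ cong parity (f r r′) ⟩
    parity ((r + r′) + (r + r′) + 0)                           ≡⟨ parity-double (r + r′) 0 ⟩
    0                                                       ∎
    where open ≡-Reasoning

-- With G the number of forced edges, the measure `2G + 2μ + parity (a + μ)` gains at least one per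
-- extension. A larger minimum gains two and loses at most one through the parity. An unchanged
-- minimum either forces an edge (odd `a + μ`) or raises the parity term (even `a + μ`).
progress : ∀ a μ d → μ ≤ d → 2 * μ + parity (a + μ) + 1 ≤ 2 * parity (a + d) + 2 * d + parity (suc a + d)
progress a μ d μ≤d with m≤n⇒m<n∨m≡n μ≤d
... | inj₁ μ<d = begin
  2 * μ + parity (a + μ) + 1        ≤⟨ +-monoˡ-≤ 1 (+-monoʳ-≤ (2 * μ) (parity≤1 (a + μ))) ⟩
  2 * μ + 1 + 1                  ≡⟨ e μ ⟩
  2 * suc μ                      ≤⟨ *-monoʳ-≤ 2 μ<d ⟩
  2 * d                          ≤⟨ m≤n+m _ (2 * parity (a + d)) ⟩
  2 * parity (a + d) + 2 * d        ≤⟨ m≤m+n _ _ ⟩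
  2 * parity (a + d) + 2 * d + parity (suc a + d) ∎
  where
  open ≤-Reasoning
  e : ∀ μ → 2 * μ + 1 + 1 ≡ 2 * suc μ
  e = solve-∀
... | inj₂ refl = begin
  2 * μ + parity (a + μ) + 1                            ≤⟨ +-monoʳ-≤ (2 * μ + parity (a + μ)) (parity-suc (a + μ)) ⟩
  2 * μ + parity (a + μ) + (parity (a + μ) + parity (suc a + μ)) ≡⟨ e μ (parity (a + μ)) _ ⟩
  2 * parity (a + μ) + 2 * μ + parity (suc a + μ)          ∎
  where
  open ≤-Reasoning
  e : ∀ μ p q → 2 * μ + p + (p + q) ≡ 2 * p + 2 * μ + q
  e = solve-∀

-- While the number of outside vertices falls from 2 M to M, G counts the edges Enforcer was forced to add. An extension that forces
-- no edge and leaves μ unchanged flips a + μ to odd, hence is followed by one that does not: G + μ grows by one in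
-- every two extensions. As μ < k, this makes G ≥ M / 4, raising the average of D from j / 8 to (j + 1) / 8.
module Block (k j M M₁ : ℕ) (M≡ : suc M₁ ≡ M) where

  -- The two inequalities before the conclusion are invariants at `M + i` outside vertices, cleared
  -- of denominators. The average of D is at least j/8 + G/(2M), each forced edge being credited
  -- with 1/(2M) only, since there are never more than 2M vertices to share it. The measure of
  -- `progress` is at least the number M - i of extensions made so far.
  block : 4 * k ≤ M →
          (∀ a D μ → μ < k → Even (D + tri a) → M * suc j ≤ 8 * D → Quota k M₁ a D μ) →
          ∀ i → i ≤ M → ∀ a D μ G → μ < k → Even (D + tri a) →
          (M + i) * (2 * M * j + 8 * G) ≤ 16 * M * D →
          2 * M ≤ 2 * G + (2 * μ + parity (a + μ)) + (M + i) → Quota k (i + M₁) a D μ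
  block 4k≤M cont zero _ a D μ G μ<k ev avg prog = cont a D μ μ<k ev (begin
    M * suc j                ≡⟨ e₁ M j ⟩
    M * j + M                ≤⟨ +-monoʳ-≤ (M * j) M≤4G ⟩
    M * j + 4 * G            ≤⟨ *-cancelˡ-≤ (2 * M) ⦃ subst (λ z → NonZero (2 * z)) M≡ _ ⦄ (begin
      2 * M * (M * j + 4 * G)           ≡⟨ e₂ M j G ⟩
      (M + 0) * (2 * M * j + 8 * G)     ≤⟨ avg ⟩
      16 * M * D                        ≡⟨ e₃ M D ⟩
      2 * M * (8 * D)                   ∎) ⟩
    8 * D                    ∎)
    where
    open ≤-Reasoning
    e₁ : ∀ M j → M * suc j ≡ M * j + M
    e₁ = solve-∀
    e₂ : ∀ M j G → 2 * M * (M * j + 4 * G) ≡ (M + 0) * (2 * M * j + 8 * G)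
    e₂ = solve-∀
    e₃ : ∀ M D → 16 * M * D ≡ 2 * M * (8 * D)
    e₃ = solve-∀
    e₅ : ∀ G X M → 2 * G + X + (M + 0) ≡ M + (2 * G + X)
    e₅ = solve-∀
    e₆ : ∀ G μ → 2 * (2 * G + (2 * μ + 1)) + 2 ≡ 4 * G + 4 * suc μ
    e₆ = solve-∀
    M≤ : M ≤ 2 * G + (2 * μ + 1)
    M≤ = begin
      M ≤⟨ +-cancelˡ-≤ M _ _ (≤-trans (≤-reflexive (cong (M +_) (sym (+-identityʳ M)))) (≤-trans prog (≤-reflexive (e₅ G _ M)))) ⟩
      2 * G + (2 * μ + parity (a + μ)) ≤⟨ +-monoʳ-≤ (2 * G) (+-monoʳ-≤ (2 * μ) (parity≤1 (a + μ))) ⟩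
      2 * G + (2 * μ + 1) ∎
    M≤4G : M ≤ 4 * G
    M≤4G = +-cancelʳ-≤ M M (4 * G) (begin
      M + M                               ≤⟨ m≤m+n _ 2 ⟩
      M + M + 2                           ≡⟨ cong (λ z → M + z + 2) (sym (+-identityʳ M)) ⟩
      2 * M + 2                           ≤⟨ +-monoˡ-≤ 2 (*-monoʳ-≤ 2 M≤) ⟩
      2 * (2 * G + (2 * μ + 1)) + 2       ≡⟨ e₆ G μ ⟩
      4 * G + 4 * suc μ                   ≤⟨ +-monoʳ-≤ (4 * G) (≤-trans (*-monoʳ-≤ 4 μ<k) 4k≤M) ⟩
      4 * G + M                           ∎)
  block 4k≤M cont (suc i) i<M a D μ G μ<k ev avg prog d μ≤d d<k md D′ D≤ ev′ =
    block 4k≤M cont i (<⇒≤ i<M) (suc a) D′ d (G + δ) d<k ev′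
      (*-cancelˡ-≤ m (+-cancelʳ-≤ (16 * M * D) _ _ (begin
        m * ((M + i) * (2 * M * j + 8 * (G + δ))) + 16 * M * D
          ≡⟨ e₁ M i j G δ D ⟩
        (M + i) * ((M + suc i) * (2 * M * j + 8 * G)) + (8 * (M + i)) * (m * δ) + 16 * M * D
          ≤⟨ +-monoˡ-≤ (16 * M * D) (+-mono-≤ (*-monoʳ-≤ (M + i) avg) (*-monoˡ-≤ (m * δ) (*-monoʳ-≤ 8 (+-monoʳ-≤ M (<⇒≤ i<M))))) ⟩
        (M + i) * (16 * M * D) + (8 * (M + M)) * (m * δ) + 16 * M * D
          ≡⟨ e₂ M i δ D ⟩
        16 * M * (m * (D + δ))
          ≤⟨ *-monoʳ-≤ (16 * M) (*-monoʳ-≤ m (forced a D d D′ ev ev′ D≤)) ⟩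
        16 * M * (m * (D′ + d))
          ≡⟨ e₃ M m D′ d ⟩
        m * (16 * M * D′) + 16 * M * (m * d)
          ≤⟨ +-monoʳ-≤ (m * (16 * M * D′)) (*-monoʳ-≤ (16 * M) (≤-trans (≤-reflexive (cong (_* d) m≡)) md)) ⟩
        m * (16 * M * D′) + 16 * M * D ∎)))
      (+-cancelʳ-≤ 1 _ _ (+-cancelʳ-≤ (2 * μ + parity (a + μ)) _ _ (begin
        2 * M + 1 + (2 * μ + parity (a + μ))
          ≤⟨ +-monoˡ-≤ _ (+-monoˡ-≤ 1 prog) ⟩
        2 * G + P + (M + suc i) + 1 + P
          ≡⟨ f₁ G P M i ⟩
        2 * G + (M + suc i) + P + (P + 1)
          ≤⟨ +-monoʳ-≤ (2 * G + (M + suc i) + P) (progress a μ d μ≤d) ⟩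
        2 * G + (M + suc i) + P + (2 * δ + 2 * d + parity (suc a + d))
          ≡⟨ f₂ G P M i δ (2 * d) _ ⟩
        2 * (G + δ) + (2 * d + parity (suc a + d)) + (M + i) + 1 + (2 * μ + parity (a + μ)) ∎)))
    where
    open ≤-Reasoning
    δ = parity (a + d)
    m = suc (M + i)
    P = 2 * μ + parity (a + μ)
    m≡ : m ≡ 2 + (i + M₁)
    m≡ = cong suc (trans (cong (_+ i) (sym M≡)) (cong suc (+-comm M₁ i)))
    e₁ : ∀ M i j G δ D → suc (M + i) * ((M + i) * (2 * M * j + 8 * (G + δ))) + 16 * M * D
       ≡ (M + i) * ((M + suc i) * (2 * M * j + 8 * G)) + (8 * (M + i)) * (suc (M + i) * δ) + 16 * M * D
    e₁ = solve-∀
    e₂ : ∀ M i δ D → (M + i) * (16 * M * D) + (8 * (M + M)) * (suc (M + i) * δ) + 16 * M * D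
       ≡ 16 * M * (suc (M + i) * (D + δ))
    e₂ = solve-∀
    e₃ : ∀ M m D d → 16 * M * (m * (D + d)) ≡ m * (16 * M * D) + 16 * M * (m * d)
    e₃ = solve-∀
    f₁ : ∀ G P M i → 2 * G + P + (M + suc i) + 1 + P ≡ 2 * G + (M + suc i) + P + (P + 1)
    f₁ = solve-∀
    f₂ : ∀ G P M i δ d p → 2 * G + (M + suc i) + P + (2 * δ + d + p) ≡ 2 * (G + δ) + (d + p) + (M + i) + 1 + P
    f₂ = solve-∀

-- A harmonic sum by halving: each of the `h` remaining halvings of the outside set is one `block`
-- and raises `j` by one. When 4k vertices are left, `j` has reached 8k and `descend` takes over.
blocks : ∀ k → 0 < k → ∀ h j → 8 * k ≤ j + h → ∀ M₁ → suc M₁ ≡ 4 * k * 2 ^ h →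
         ∀ a D μ → μ < k → Even (D + tri a) → suc M₁ * j ≤ 8 * D → Quota k M₁ a D μ
blocks k 0<k zero j le M₁ eq a D μ μ<k ev avg =
  descend k j (≤-trans le (≤-reflexive (+-identityʳ j))) M₁ a D μ avg
blocks k@(suc k₁) 0<k (suc h) j le M₁ eq a D μ μ<k ev avg =
  subst (λ z → Quota k z a D μ) (suc-injective (trans (sym (+-suc N N₁)) (trans (cong (N +_) eqN) (sym eqM))))
    (block 4k≤N (λ a D μ μ<k ev avg → blocks k 0<k h (suc j) (≤-trans le (≤-reflexive (+-suc j h))) N₁ eqN a D μ μ<k ev (≤-trans (≤-reflexive (cong (_* suc j) eqN)) avg))
      N ≤-refl a D μ 0 μ<k ev
      (begin
        (N + N) * (2 * N * j + 8 * 0)     ≡⟨ e₁ N j ⟩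
        2 * N * ((N + N) * j)             ≤⟨ *-monoʳ-≤ (2 * N) (≤-trans (≤-reflexive (cong (_* j) (sym eqM))) avg) ⟩
        2 * N * (8 * D)                   ≡⟨ e₂ N D ⟩
        16 * N * D                        ∎)
      (≤-trans (≤-reflexive (cong (N +_) (+-identityʳ N))) (m≤n+m (N + N) (2 * μ + parity (a + μ)))))
  where
  open ≤-Reasoning
  N = 4 * k * 2 ^ h
  N₁ = pred N
  instance
    N≢0 : NonZero N
    N≢0 = m*n≢0 (4 * k) (2 ^ h) ⦃ _ ⦄ ⦃ m^n≢0 2 h ⦄
  eqN : suc N₁ ≡ N
  eqN = suc-pred N
  open Block k j N N₁ eqN
  4k≤N : 4 * k ≤ N
  4k≤N = m≤m*n (4 * k) (2 ^ h) ⦃ m^n≢0 2 h ⦄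
  e₀ : ∀ k x → 4 * k * (2 * x) ≡ 4 * k * x + 4 * k * x
  e₀ = solve-∀
  eqM : suc M₁ ≡ N + N
  eqM = trans eq (e₀ k (2 ^ h))
  e₁ : ∀ N j → (N + N) * (2 * N * j + 8 * 0) ≡ 2 * N * ((N + N) * j)
  e₁ = solve-∀
  e₂ : ∀ N D → 2 * N * (8 * D) ≡ 16 * N * D
  e₂ = solve-∀

quota-start : ∀ k → 0 < k → ∀ M₁ → suc M₁ ≡ 4 * k * 2 ^ (8 * k) → ∀ a D → Even (D + tri a) → Quota k M₁ a D 0
quota-start k 0<k M₁ eq a D ev = blocks k 0<k (8 * k) 0 ≤-refl M₁ eq a D 0 0<k ev (≤-trans (≤-reflexive (*-zeroʳ (suc M₁))) z≤n)

-- Avoider's strategy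

outside : ∀ {n} → (Fin n → Bool) → Edge n → Bool
outside S e = not (inside S e)

-- For x outside S these are the edges between x and S, and the loop at x, which is not on the
-- board. Taking the difference of two `inside` sets makes the counts telescope when S grows.
link : ∀ {n} → Fin n → (Fin n → Bool) → Edge n → Bool
link x S e = inside (S ∪ x) e ∧ outside S e

module _ {n : ℕ} (S : Fin n → Bool) where

  inside+outside : ∀ e → ⟦ inside S e ⟧ + ⟦ outside S e ⟧ ≡ 1
  inside+outside e with inside S e
  ... | true = refl
  ... | false = refl

  inside-∪ : ∀ x e → ⟦ inside (S ∪ x) e ⟧ ≡ ⟦ link x S e ⟧ + ⟦ inside S e ⟧
  inside-∪ x (i , j) = lem (S i) (S j) (i == x) (j == x)
    where
    lem : ∀ a b c d → ⟦ (a ∨ c) ∧ (b ∨ d) ⟧ ≡ ⟦ ((a ∨ c) ∧ (b ∨ d)) ∧ not (a ∧ b) ⟧ + ⟦ a ∧ b ⟧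
    lem true true c d = refl
    lem true false c true = refl
    lem true false c false = refl
    lem false true true d = refl
    lem false true false d = refl
    lem false false true true = refl
    lem false false true false = refl
    lem false false false d = refl

  outside-∪ : ∀ x e → ⟦ outside S e ⟧ ≡ ⟦ link x S e ⟧ + ⟦ outside (S ∪ x) e ⟧
  outside-∪ x (i , j) = lem (S i) (S j) (i == x) (j == x)
    where
    lem : ∀ a b c d → ⟦ not (a ∧ b) ⟧ ≡ ⟦ ((a ∨ c) ∧ (b ∨ d)) ∧ not (a ∧ b) ⟧ + ⟦ not ((a ∨ c) ∧ (b ∨ d)) ⟧
    lem true true c d = refl
    lem true false c true = refl
    lem true false c false = refl
    lem false true true d = refl
    lem false true false d = refl
    lem false false true true = refl
    lem false false true false = refl
    lem false false false d = refl

  link-split : ∀ x i j → link x S (i , j) ≡ true → S i ≡ false × i ≡ x ⊎ S j ≡ false × j ≡ x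
  link-split x i j eq with S i | S j | i ≟ x | j ≟ x
  ... | false | _ | yes i≡x | _ = inj₁ (refl , i≡x)
  ... | true | false | _ | yes j≡x = inj₂ (refl , j≡x)
  link-split x i j () | true | true | yes _ | yes _
  link-split x i j () | true | true | yes _ | no _
  link-split x i j () | true | true | no _ | yes _
  link-split x i j () | true | true | no _ | no _

  -- An edge outside S can link S to one outside vertex at most, namely its first end not in S. This
  -- bounds the sum of the degrees into S by D.
  ∑-link : ∀ e → sum (λ x → ⟦ not (S x) ⟧ * ⟦ link x S e ⟧) ≤ ⟦ outside S e ⟧
  ∑-link (i , j) with S i in Si | S j in Sj
  ... | true | true = ≤-trans (∑-mono λ x → ≤-reflexive (trans (cong (⟦ not (S x) ⟧ *_) (cong ⟦_⟧ (𝔹.∧-zeroʳ ((true ∨ i == x) ∧ (true ∨ j == x))))) (*-zeroʳ ⟦ not (S x) ⟧))) (≤-reflexive (∑-zero n))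
  ... | true | false = ≤-trans (∑-mono bound) (∑-== j)
    where
    bound : ∀ x → ⟦ not (S x) ⟧ * ⟦ (j == x) ∧ true ⟧ ≤ ⟦ x == j ⟧
    bound x with j ≟ x
    ... | yes refl rewrite ==-refl j = ≤-trans (≤-reflexive (*-identityʳ ⟦ not (S j) ⟧)) (⟦⟧≤1 (not (S j)))
    ... | no _ = ≤-trans (≤-reflexive (*-zeroʳ ⟦ not (S x) ⟧)) z≤n
  ... | false | b = ≤-trans (∑-mono bound) (∑-== i)
    where
    bound : ∀ x → ⟦ not (S x) ⟧ * ⟦ (i == x ∧ (b ∨ j == x)) ∧ true ⟧ ≤ ⟦ x == i ⟧
    bound x with i ≟ x
    ... | yes refl rewrite ==-refl i = *-mono-≤ (⟦⟧≤1 (not (S i))) (⟦⟧≤1 ((b ∨ j == i) ∧ true))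
    ... | no _ = ≤-trans (≤-reflexive (*-zeroʳ ⟦ not (S x) ⟧)) z≤n

  -- Degrees into S do not fall as S grows, so the least degree at one extension is a valid `μ` for
  -- the next.
  link-mono : ∀ {x y} → S y ≡ false → y ≢ x → ∀ e → ⟦ link y S e ⟧ ≤ ⟦ link y (S ∪ x) e ⟧
  link-mono {x} {y} Sy y≢x (i , j) with i ≟ y | j ≟ y
  ... | yes refl | yes refl rewrite Sy | ==-≢ y≢x = ≤-refl
  ... | yes refl | no _ rewrite Sy | ==-≢ y≢x = lem (S j) (j == x)
    where
    lem : ∀ b c → ⟦ (b ∨ false) ∧ true ⟧ ≤ ⟦ ((b ∨ c) ∨ false) ∧ true ⟧
    lem true c = ≤-refl
    lem false c = z≤n
  ... | no _ | yes refl rewrite Sy | ==-≢ y≢x = lem (S i) (i == x)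
    where
    lem : ∀ b c → ⟦ ((b ∨ false) ∧ true) ∧ not (b ∧ false) ⟧ ≤ ⟦ (((b ∨ c) ∨ false) ∧ true) ∧ not ((b ∨ c) ∧ false) ⟧
    lem true c = ≤-refl
    lem false c = z≤n
  ... | no _ | no _ = lem (S i) (S j)
    where
    lem : ∀ a b {c} → ⟦ ((a ∨ false) ∧ (b ∨ false)) ∧ not (a ∧ b) ⟧ ≤ c
    lem true true = z≤n
    lem true false = z≤n
    lem false b = z≤n

  -- Obtained as a difference of two values of `tri`, which avoids any case distinction on the order
  -- of the endpoints.
  link-count : ∀ x → S x ≡ false → wt (⟦_⟧ ∘ link x S) (allEdges n) ≡ size S
  link-count x Sx = +-cancelʳ-≡ (tri (size S)) _ _ (begin
    wt (⟦_⟧ ∘ link x S) (allEdges n) + tri (size S)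
      ≡⟨ cong (wt (⟦_⟧ ∘ link x S) (allEdges n) +_) (wt-inside S) ⟨
    wt (⟦_⟧ ∘ link x S) (allEdges n) + wt (⟦_⟧ ∘ inside S) (allEdges n)
      ≡⟨ wt-+ (⟦_⟧ ∘ link x S) (⟦_⟧ ∘ inside S) (allEdges n) ⟨
    wt (λ e → ⟦ link x S e ⟧ + ⟦ inside S e ⟧) (allEdges n)
      ≡⟨ wt-cong (inside-∪ x) (allEdges n) ⟨
    wt (⟦_⟧ ∘ inside (S ∪ x)) (allEdges n)
      ≡⟨ wt-inside (S ∪ x) ⟩
    tri (size (S ∪ x))
      ≡⟨ cong tri (size-∪ S x Sx) ⟩
    size S + tri (size S) ∎)
    where open ≡-Reasoning

-- A form of "claimed and free edges partition the board" that quantifies over weights: every count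
-- needed later is one choice of `w`.
Balanced : ∀ {n} → List (Edge n) → List (Edge n) → Set
Balanced {n} C U = ∀ w → wt w C + wt w U ≡ wt w (allEdges n)

balanced-─ : ∀ {n} {C U : List (Edge n)} {e} (p : e ∈ U) → Balanced C U → Balanced (e ∷ C) (U ─ p)
balanced-─ {n} {C} {U} {e} p bal w = begin
  w e + wt w C + wt w (U ─ p)       ≡⟨ lem (w e) _ _ ⟩
  wt w C + (w e + wt w (U ─ p))     ≡⟨ cong (wt w C +_) (wt-─ w p) ⟩
  wt w C + wt w U                   ≡⟨ bal w ⟩
  wt w (allEdges n)                 ∎
  where
  open ≡-Reasoning
  lem : ∀ a b c → a + b + c ≡ b + (a + c)
  lem = solve-∀

balanced-── : ∀ {n} {C U : List (Edge n)} {e e′} (p : e ∈ U) (q : e′ ∈ (U ─ p)) →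
              Balanced C U → Balanced (e′ ∷ e ∷ C) ((U ─ p) ─ q)
balanced-── {C = C} {e = e} p q bal = balanced-─ {C = e ∷ C} q (balanced-─ {C = C} p bal)

wt-∷∷ : ∀ {A : Set} (w : A → ℕ) C {e e′} → wt w C ≤ wt w (e′ ∷ e ∷ C)
wt-∷∷ w C {e} {e′} = ≤-trans (m≤n+m (wt w C) (w e)) (m≤n+m (w e + wt w C) (w e′))

one : ∀ {A : Set} → A → ℕ
one _ = 1

not-true : ∀ {b} → not b ≡ true → b ≡ false
not-true {false} _ = refl

not-false : ∀ {b} → b ≡ false → not b ≡ true
not-false refl = refl

⟦⟧-pos : ∀ {b} → 0 < ⟦ b ⟧ → b ≡ true
⟦⟧-pos {true} _ = refl

link⇒inside : ∀ {n} x (S : Fin n → Bool) e → link x S e ≡ true → inside (S ∪ x) e ≡ true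
link⇒inside x S e eq with inside (S ∪ x) e
... | true = refl

inside-mono : ∀ {n} {S S′ : Fin n → Bool} → (∀ i → S i ≡ true → S′ i ≡ true) → ∀ e → inside S e ≡ true → inside S′ e ≡ true
inside-mono {S = S} sub (i , j) eq with S i in Si | S j in Sj
... | true | true rewrite sub i Si | sub j Sj = refl

∪-⊆ : ∀ {n} (S : Fin n → Bool) x i → S i ≡ true → (S ∪ x) i ≡ true
∪-⊆ S x i Si rewrite Si = refl

-- The vertex `x` is isolated in Avoider's graph.
avoids⇒¬Lost : ∀ {n} (S : Fin n → Bool) {x} → S x ≡ false → ∀ {A} → (∀ e → e ∈ A → inside S e ≡ true) → ¬ Lost (𝒟 n) A
avoids⇒¬Lost S {x} Sx av (H , H⊆A , dom) with dom x
... | u , inj₁ p with av _ (H⊆A p)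
... | eq rewrite Sx with eq
... | ()
avoids⇒¬Lost S {x} Sx av (H , H⊆A , dom) | u , inj₂ p with av _ (H⊆A p)
... | eq rewrite Sx with trans (sym eq) (𝔹.∧-zeroʳ (S u))
... | ()

module Avoider (n k : ℕ) where

  -- Since `m` is one less than the number of vertices outside S, some vertex always stays isolated.
  -- The field `quota` covers every value D may have when S is next exhausted, hence its
  -- quantification over larger D of the right parity. By `k≤size`, a vertex of claimed degree below
  -- k still has a free edge into S.
  record State (A C U : List (Edge (suc n))) (r : ℕ) : Set where
    field
      S : Fin (suc n) → Bool
      m : ℕ
      size-S : size S + m ≡ n
      k≤size : k ≤ size S
      balanced : Balanced C U
      rounds : wt one C ≡ r + r
      avoids : ∀ e → e ∈ A → inside S e ≡ true
      μ : ℕ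
      μ≤ : ∀ x → S x ≡ false → μ ≤ wt (⟦_⟧ ∘ link x S) C
      quota : ∀ D → wt (⟦_⟧ ∘ outside S) C ≤ D → Even (D + tri (size S)) → Quota k m (size S) D μ

    size-∁S : size (∁ S) ≡ suc m
    size-∁S = +-cancelʳ-≡ (size S) _ _ (trans (size-∁ S) (cong suc (trans (sym size-S) (+-comm (size S) m))))

    unused : ∃[ x ] S x ≡ false
    unused with size-pos (∁ S) (subst (0 <_) (sym size-∁S) (s≤s z≤n))
    ... | x , eq = x , not-true eq

    -- All `tri (size S)` inside edges are among the 2r claimed ones; the others lie outside. This
    -- is the source of the evenness in `Quota`.
    stuck : wt (⟦_⟧ ∘ inside S) U ≡ 0 → wt (⟦_⟧ ∘ outside S) C + tri (size S) ≡ r + r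
    stuck eq = begin
      wt (⟦_⟧ ∘ outside S) C + tri (size S)
        ≡⟨ cong (wt (⟦_⟧ ∘ outside S) C +_) (wt-inside S) ⟨
      wt (⟦_⟧ ∘ outside S) C + wt (⟦_⟧ ∘ inside S) (allEdges (suc n))
        ≡⟨ cong (wt (⟦_⟧ ∘ outside S) C +_) (trans (sym (balanced (⟦_⟧ ∘ inside S))) (trans (cong (wt (⟦_⟧ ∘ inside S) C +_) eq) (+-identityʳ _))) ⟩
      wt (⟦_⟧ ∘ outside S) C + wt (⟦_⟧ ∘ inside S) C
        ≡⟨ +-comm (wt (⟦_⟧ ∘ outside S) C) _ ⟩
      wt (⟦_⟧ ∘ inside S) C + wt (⟦_⟧ ∘ outside S) C
        ≡⟨ wt-+ (⟦_⟧ ∘ inside S) (⟦_⟧ ∘ outside S) C ⟨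
      wt (λ e → ⟦ inside S e ⟧ + ⟦ outside S e ⟧) C
        ≡⟨ wt-cong (inside+outside S) C ⟩
      wt one C
        ≡⟨ rounds ⟩
      r + r ∎
      where open ≡-Reasoning

  open State

  -- A vertex of claimed degree k is enough: Avoider then only has to keep that one vertex isolated.
  Small : ∀ {A C U r} → State A C U r → Set
  Small {C = C} st = m st ≡ 0 ⊎ (∀ x → S st x ≡ false → wt (⟦_⟧ ∘ link x (S st)) C < k)

  focus : ∀ {A C U r} (st : State A C U r) x → S st x ≡ false → k ≤ wt (⟦_⟧ ∘ link x (S st)) C → State A C U r
  focus {C = C} st x Sx k≤d = record
    { S = R ; m = 0 ; size-S = trans (+-identityʳ _) size-R ; k≤size = ≤-trans (k≤size st) (size-mono S⊆R)
    ; balanced = balanced st ; rounds = rounds st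
    ; avoids = λ e p → inside-mono S⊆R e (avoids st e p)
    ; μ = 0 ; μ≤ = λ _ _ → z≤n
    -- For `m = 0` the quota reads `k ≤ D`, and the claimed links at x all lie outside the new set.
    ; quota = λ D D≥ _ → ≤-trans k≤d (≤-trans (wt-mono link≤ C) D≥)
    }
    where
    only : Fin (suc n) → Bool
    only v = v == x
    R : Fin (suc n) → Bool
    R = ∁ only
    size-only : size only ≡ 1
    size-only = ≤-antisym (∑-== x) (≤-trans (≤-reflexive (cong ⟦_⟧ (sym (==-refl x)))) (term≤∑ (⟦_⟧ ∘ only) x))
    size-R : size R ≡ n
    size-R = suc-injective (trans (+-comm 1 _) (trans (cong (size R +_) (sym size-only)) (size-∁ only)))
    S⊆R : ∀ i → S st i ≡ true → R i ≡ true
    S⊆R i Si with i ≟ x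
    ... | yes refl = contradiction (trans (sym Si) Sx) λ ()
    ... | no _ = refl
    link≤ : ∀ e → ⟦ link x (S st) e ⟧ ≤ ⟦ outside R e ⟧
    link≤ (i , j) with link x (S st) (i , j) in eq
    ... | false = z≤n
    ... | true with link-split (S st) x i j eq
    ... | inj₁ (_ , refl) rewrite ==-refl i = ≤-refl
    ... | inj₂ (_ , refl) rewrite ==-refl j | 𝔹.∧-zeroʳ (R i) = ≤-refl

  normalise : ∀ {A C U r} → State A C U r → ∃ (Small {A} {C} {U} {r})
  normalise {C = C} st with any? (λ x → (S st x 𝔹.≟ false) ×-dec (k ≤? wt (⟦_⟧ ∘ link x (S st)) C))
  ... | yes (x , Sx , k≤d) = focus st x Sx k≤d , inj₁ refl
  ... | no ∄ = st , inj₂ λ x Sx → ≰⇒> λ k≤d → ∄ (x , Sx , k≤d)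

  stay : ∀ {A C U r} (st : State A C U r) {e e′} (p : e ∈ U) (q : e′ ∈ (U ─ p)) → inside (S st) e ≡ true →
         State (e ∷ A) (e′ ∷ e ∷ C) ((U ─ p) ─ q) (suc r)
  stay {C = C} {r = r} st {e} {e′} p q in-e = record
    { S = S st ; m = m st ; size-S = size-S st ; k≤size = k≤size st
    ; balanced = balanced-── {C = C} p q (balanced st)
    ; rounds = trans (cong (2 +_) (rounds st)) (cong suc (sym (+-suc r r)))
    ; avoids = λ { _ (here refl) → in-e ; _ (there p′) → avoids st _ p′ }
    ; μ = μ st ; μ≤ = λ x Sx → ≤-trans (μ≤ st x Sx) (wt-∷∷ (⟦_⟧ ∘ link x (S st)) C)
    ; quota = λ D D≥ → quota st D (≤-trans (wt-∷∷ (⟦_⟧ ∘ outside (S st)) C) D≥)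
    }

  extend : ∀ {A C U r} (st : State A C U r) {m₁} → m st ≡ suc m₁ → wt (⟦_⟧ ∘ inside (S st)) U ≡ 0 →
           ∀ x → S st x ≡ false → (∀ y → S st y ≡ false → wt (⟦_⟧ ∘ link x (S st)) C ≤ wt (⟦_⟧ ∘ link y (S st)) C) →
           wt (⟦_⟧ ∘ link x (S st)) C < k →
           ∀ {e e′} (p : e ∈ U) (q : e′ ∈ (U ─ p)) → link x (S st) e ≡ true →
           State (e ∷ A) (e′ ∷ e ∷ C) ((U ─ p) ─ q) (suc r)
  extend {A} {C} {U} {r} st {m₁} m≡ no-free x Sx min d<k {e} {e′} p q link-e = record
    { S = R ; m = m₁ ; size-S = trans (cong (_+ m₁) size-R) (trans (sym (+-suc _ m₁)) (trans (cong (size (S st) +_) (sym m≡)) (size-S st)))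
    ; k≤size = ≤-trans (k≤size st) (size-mono S⊆R)
    ; balanced = balanced-── {C = C} p q (balanced st)
    ; rounds = trans (cong (2 +_) (rounds st)) (cong suc (sym (+-suc r r)))
    ; avoids = λ { _ (here refl) → link⇒inside x (S st) e link-e ; _ (there p′) → inside-mono S⊆R _ (avoids st _ p′) }
    ; μ = d
    ; μ≤ = μ≤′
    ; quota = quota′
    }
    where
    R = S st ∪ x
    d = wt (⟦_⟧ ∘ link x (S st)) C
    D = wt (⟦_⟧ ∘ outside (S st)) C
    S⊆R = ∪-⊆ (S st) x
    size-R : size R ≡ suc (size (S st))
    size-R = size-∪ (S st) x Sx
    μ≤′ : ∀ y → R y ≡ false → d ≤ wt (⟦_⟧ ∘ link y R) (e′ ∷ e ∷ C)
    μ≤′ y Ry with S st y in Sy | y ≟ x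
    μ≤′ y () | true | _
    μ≤′ y () | false | yes _
    ... | false | no y≢x = ≤-trans (min y Sy) (≤-trans (wt-mono (link-mono (S st) Sy y≢x) C) (wt-∷∷ (⟦_⟧ ∘ link y R) C))
    D≤ : D ≤ wt (⟦_⟧ ∘ outside R) C + d
    D≤ = ≤-reflexive (begin-equality
      D                                                      ≡⟨ wt-cong (outside-∪ (S st) x) C ⟩
      wt (λ e → ⟦ link x (S st) e ⟧ + ⟦ outside R e ⟧) C     ≡⟨ wt-+ (⟦_⟧ ∘ link x (S st)) (⟦_⟧ ∘ outside R) C ⟩
      d + wt (⟦_⟧ ∘ outside R) C                             ≡⟨ +-comm d _ ⟩
      wt (⟦_⟧ ∘ outside R) C + d                             ∎)
      where open ≤-Reasoning
    -- The least degree is at most the average, and the degree sum is at most D by `∑-link`.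
    average : (2 + m₁) * d ≤ D
    average = begin
      (2 + m₁) * d                                                                   ≡⟨ cong (_* d) (trans (cong suc (sym m≡)) (sym (size-∁S st))) ⟩
      size (∁ (S st)) * d                                                            ≤⟨ size*≤∑ (∁ (S st)) _ d (λ y eq → min y (not-true eq)) ⟩
      sum (λ y → ⟦ not (S st y) ⟧ * wt (⟦_⟧ ∘ link y (S st)) C)                      ≡⟨ sum-cong-≗ (λ y → wt-scale ⟦ not (S st y) ⟧ (⟦_⟧ ∘ link y (S st)) C) ⟩
      sum (λ y → wt (λ e → ⟦ not (S st y) ⟧ * ⟦ link y (S st) e ⟧) C)                ≡⟨ wt-∑ (λ y e → ⟦ not (S st y) ⟧ * ⟦ link y (S st) e ⟧) C ⟩
      wt (λ e → sum (λ y → ⟦ not (S st y) ⟧ * ⟦ link y (S st) e ⟧)) C                ≤⟨ wt-mono (∑-link (S st)) C ⟩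
      D                                                                              ∎
      where
      open ≤-Reasoning
      wt-scale : ∀ c w (L : List (Edge (suc n))) → c * wt w L ≡ wt (λ e → c * w e) L
      wt-scale c w [] = *-zeroʳ c
      wt-scale c w (e ∷ L) = trans (*-distribˡ-+ c (w e) (wt w L)) (cong (c * w e +_) (wt-scale c w L))
    quota′ : ∀ D′ → wt (⟦_⟧ ∘ outside R) (e′ ∷ e ∷ C) ≤ D′ → Even (D′ + tri (size R)) → Quota k m₁ (size R) D′ d
    quota′ D′ D′≥ ev = subst (λ z → Quota k m₁ z D′ d) (sym size-R)
      (subst (λ z → Quota k z (size (S st)) D (μ st)) m≡ (quota st D ≤-refl (r , stuck st no-free)) d (μ≤ st x Sx) d<k average D′
        (≤-trans D≤ (+-monoˡ-≤ d (≤-trans (wt-∷∷ (⟦_⟧ ∘ outside R) C) D′≥)))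
        (subst (λ z → Even (D′ + tri z)) size-R ev))

  -- While S misses a vertex Enforcer has not won. Avoider plays inside S, or extends S once it is
  -- exhausted. The play that bounds the length is the one in which S misses a single vertex and is
  -- exhausted.
  lasts : ∀ s {A C U r} → State A C U r → EnforcerWithin (𝒟 (suc n)) s A U → tri n + k ≤ (r + s) + (r + s)

  lasts-next : ∀ s {A C U r e} (p : e ∈ U) (S′ : Fin (suc n) → Bool) {x} → S′ x ≡ false → inside S′ e ≡ true →
    (∀ e → e ∈ A → inside S′ e ≡ true) →
    (∀ {e′} (q : e′ ∈ (U ─ p)) → State (e ∷ A) (e′ ∷ e ∷ C) ((U ─ p) ─ q) (suc r)) →
    Lost (𝒟 (suc n)) (e ∷ A) ⊎ (∃[ e′ ] ∃ λ (q : e′ ∈ (U ─ p)) → EnforcerWithin (𝒟 (suc n)) s (e ∷ A) ((U ─ p) ─ q)) →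
    tri n + k ≤ (r + suc s) + (r + suc s)
  lasts-next s p S′ S′x in-e av next (inj₁ lost) =
    contradiction lost (avoids⇒¬Lost S′ S′x λ { _ (here refl) → in-e ; _ (there p′) → av _ p′ })
  lasts-next s {r = r} p S′ S′x in-e av next (inj₂ (e′ , q , W)) =
    subst (λ z → tri n + k ≤ z + z) (sym (+-suc r s)) (lasts s (next q) W)

  lasts zero st lost = contradiction lost (avoids⇒¬Lost (S st) (proj₂ (unused st)) (avoids st))
  lasts (suc s) st (inj₁ lost) = contradiction lost (avoids⇒¬Lost (S st) (proj₂ (unused st)) (avoids st))
  lasts (suc s) {A} {C} {U} {r} st₀ (inj₂ (_ , reply)) with normalise st₀
  ... | st , small with wt (⟦_⟧ ∘ inside (S st)) U in free
  ... | suc _ with wt-pos (⟦_⟧ ∘ inside (S st)) U (subst (0 <_) (sym free) (s≤s z≤n))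
  ... | e , p , pos = lasts-next s {C = C} p (S st) (proj₂ (unused st)) (⟦⟧-pos pos) (avoids st) (λ q → stay st p q (⟦⟧-pos pos)) (reply e p)
  lasts (suc s) {A} {C} {U} {r} st₀ (inj₂ (_ , reply)) | st , small | zero with m st in m≡
  -- Besides the `tri n` edges inside S, the quota provides k claimed edges at the last vertex, so
  -- the rounds already played suffice for the bound.
  ... | zero = begin
    tri n + k                    ≡⟨ +-comm (tri n) k ⟩
    k + tri n                    ≤⟨ +-monoˡ-≤ (tri n) (subst (λ z → Quota k z _ _ _) m≡ (quota st _ ≤-refl (r , stuck st free))) ⟩
    D + tri n                    ≡⟨ cong (λ z → D + tri z) (trans (sym (size-S st)) (trans (cong (size (S st) +_) m≡) (+-identityʳ _))) ⟩
    D + tri (size (S st))        ≡⟨ stuck st free ⟩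
    r + r                        ≤⟨ +-mono-≤ (m≤m+n r (suc s)) (m≤m+n r (suc s)) ⟩
    r + suc s + (r + suc s)      ∎
    where
    open ≤-Reasoning
    D = wt (⟦_⟧ ∘ outside (S st)) C
  ... | suc m₁ with unused st
  ... | x₀ , Sx₀ with argmin (∁ (S st)) (λ x → wt (⟦_⟧ ∘ link x (S st)) C) x₀ (not-false Sx₀)
  ... | x , ∁x , min = lasts-next s {C = C} p (S st ∪ x) {y} Ry in-e (λ e p → inside-mono (∪-⊆ (S st) x) e (avoids st e p))
        (λ q → extend st m≡ free x Sx min′ d<k p q link-e) (reply e p)
    where
    Sx : S st x ≡ false
    Sx = not-true ∁x
    min′ : ∀ y → S st y ≡ false → wt (⟦_⟧ ∘ link x (S st)) C ≤ wt (⟦_⟧ ∘ link y (S st)) C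
    min′ y Sy = min y (not-false Sy)
    d<k : wt (⟦_⟧ ∘ link x (S st)) C < k
    d<k = [ (λ ()) , (λ f → f x Sx) ]′ small
    -- Of the `size S` links at x fewer than k, hence not all, are claimed.
    available : 0 < wt (⟦_⟧ ∘ link x (S st)) U
    available = +-cancelˡ-< (wt (⟦_⟧ ∘ link x (S st)) C) 0 _ (begin-strict
      wt (⟦_⟧ ∘ link x (S st)) C + 0                                      ≡⟨ +-identityʳ _ ⟩
      wt (⟦_⟧ ∘ link x (S st)) C                                          <⟨ d<k ⟩
      k                                                                   ≤⟨ k≤size st ⟩
      size (S st)                                                         ≡⟨ link-count (S st) x Sx ⟨
      wt (⟦_⟧ ∘ link x (S st)) (allEdges (suc n))                         ≡⟨ balanced st (⟦_⟧ ∘ link x (S st)) ⟨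
      wt (⟦_⟧ ∘ link x (S st)) C + wt (⟦_⟧ ∘ link x (S st)) U             ∎)
      where open ≤-Reasoning
    found = wt-pos (⟦_⟧ ∘ link x (S st)) U available
    e = proj₁ found
    p = proj₁ (proj₂ found)
    link-e = ⟦⟧-pos (proj₂ (proj₂ found))
    in-e = link⇒inside x (S st) e link-e
    other : ∃[ y ] ∁ (S st ∪ x) y ≡ true
    other = size-pos (∁ (S st ∪ x)) (subst (0 <_) (sym size≡) (s≤s z≤n))
      where
      size≡ : size (∁ (S st ∪ x)) ≡ suc m₁
      size≡ = +-cancelʳ-≡ (suc (size (S st))) _ _ (begin
        size (∁ (S st ∪ x)) + suc (size (S st))       ≡⟨ cong (size (∁ (S st ∪ x)) +_) (size-∪ (S st) x Sx) ⟨
        size (∁ (S st ∪ x)) + size (S st ∪ x)         ≡⟨ size-∁ (S st ∪ x) ⟩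
        suc n                                         ≡⟨ cong suc (size-S st) ⟨
        suc (size (S st) + m st)                      ≡⟨ cong (λ z → suc (size (S st) + z)) m≡ ⟩
        suc (size (S st) + suc m₁)                    ≡⟨ cong suc (+-comm (size (S st)) _) ⟩
        suc (suc m₁ + size (S st))                    ≡⟨ +-suc (suc m₁) _ ⟨
        suc m₁ + suc (size (S st))                    ∎)
        where open ≡-Reasoning
    y = proj₁ other
    Ry : (S st ∪ x) y ≡ false
    Ry = not-true (proj₂ other)

-- Enforcer's strategy

Reach-trans : ∀ {n} {H : List (Edge n)} {u v w} → Reach H u v → Reach H v w → Reach H u w
Reach-trans here vw = vw
Reach-trans (step a uv) vw = step a (Reach-trans uv vw)

Reach-∷ : ∀ {n} {H : List (Edge n)} {e u v} → Reach H u v → Reach (e ∷ H) u v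
Reach-∷ here = here
Reach-∷ (step (inj₁ p) r) = step (inj₁ (there p)) (Reach-∷ r)
Reach-∷ (step (inj₂ p) r) = step (inj₂ (there p)) (Reach-∷ r)

∈-─⇒∈ : ∀ {A : Set} {x y : A} {xs} (p : x ∈ xs) → y ∈ (xs ─ p) → y ∈ xs
∈-─⇒∈ (here _) q = there q
∈-─⇒∈ (there p) (here eq) = here eq
∈-─⇒∈ (there p) (there q) = there (∈-─⇒∈ p q)

loop : ∀ {n} → Edge n → Bool
loop (i , j) = i == j

wt-loop : ∀ n → wt (⟦_⟧ ∘ loop) (allEdges n) ≡ 0
wt-loop n = trans (wt-allEdges {n} (⟦_⟧ ∘ loop)) (trans (sum-cong-≗ λ i → trans (sum-cong-≗ (cell i)) (∑-zero n)) (∑-zero n))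
  where
  cell : ∀ (i j : Fin n) → (if toℕ i <ᵇ toℕ j then ⟦ i == j ⟧ else 0) ≡ 0
  cell i j with toℕ i <ᵇ toℕ j in lt | i ≟ j
  ... | false | _ = refl
  ... | true | no _ = refl
  ... | true | yes refl = contradiction (<ᵇ⇒< (toℕ i) (toℕ i) (subst T (sym lt) _)) (n≮n _)

-- The type of edges admits loops but the board has none, so by balance no free edge is one.
no-loops : ∀ {n} {C U : List (Edge n)} {i j} → Balanced C U → (i , j) ∈ U → i ≢ j
no-loops {n} {C} {U} {i} bal p refl
  with wt-zero (⟦_⟧ ∘ loop) (m+n≡0⇒n≡0 (wt (⟦_⟧ ∘ loop) C) (trans (bal (⟦_⟧ ∘ loop)) (wt-loop n))) p
... | eq rewrite ==-refl i = contradiction eq λ ()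

wt-one : ∀ n → wt one (allEdges n) ≡ tri n
wt-one n = trans (wt-inside {n} (λ _ → true)) (cong tri (∑-one n))

touch : ∀ {n} → Fin n → Edge n → Bool
touch v (i , j) = i == v ∨ j == v

deg : ∀ {n} → Fin n → List (Edge n) → ℕ
deg v C = wt (⟦_⟧ ∘ touch v) C

same cross : ∀ {n} → (Fin n → Fin n) → Edge n → Bool
same lab (i , j) = lab i == lab j
cross lab e = not (same lab e)

Φ : ∀ {n} → (Fin n → Bool) → List (Edge n) → ℕ
Φ S C = sum (λ v → ⟦ not (S v) ⟧ * 2 ^ deg v C)

Φ-mono : ∀ {n} {S S′ : Fin n → Bool} {e C} → (∀ v → S v ≡ true → S′ v ≡ true) →
         (∀ v → S′ v ≡ false → touch v e ≡ false) →
         ∀ v → ⟦ not (S′ v) ⟧ * 2 ^ deg v (e ∷ C) ≤ ⟦ not (S v) ⟧ * 2 ^ deg v C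
Φ-mono {S = S} {S′} {e} sub avoid v with S v in Sv | S′ v in S′v
... | true | true = z≤n
... | true | false = contradiction (trans (sym S′v) (sub v Sv)) λ ()
... | false | true = z≤n
... | false | false rewrite avoid v S′v = ≤-refl

term≤Φ : ∀ {n} (S : Fin n → Bool) C v → S v ≡ false → 2 ^ deg v C ≤ Φ S C
term≤Φ S C v Sv = ≤-trans (≤-reflexive (trans (sym (+-identityʳ _)) (cong (λ b → ⟦ not b ⟧ * 2 ^ deg v C) (sym Sv)))) (term≤∑ _ v)

size≥2 : ∀ {n} (S : Fin n → Bool) {i j} → i ≢ j → S i ≡ true → S j ≡ true → 2 ≤ size S
size≥2 {n} S {i} {j} i≢j Si Sj = ≤-trans (s≤s one≤) (∑-mono-gap {f = λ v → ⟦ v == j ⟧} i {1} below gap)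
  where
  below : ∀ v → ⟦ v == j ⟧ ≤ ⟦ S v ⟧
  below v with v ≟ j
  ... | yes refl rewrite Sj = ≤-refl
  ... | no _ = z≤n
  gap : 1 + ⟦ i == j ⟧ ≤ ⟦ S i ⟧
  gap rewrite ==-≢ i≢j | Si = ≤-refl
  one≤ : 1 ≤ size (λ v → v == j)
  one≤ = ≤-trans (≤-reflexive (cong ⟦_⟧ (sym (==-refl j)))) (term≤∑ (λ v → ⟦ v == j ⟧) j)

∧-true : ∀ {a b} → a ∧ b ≡ true → a ≡ true × b ≡ true
∧-true {true} {true} _ = refl , refl

∧-false : ∀ {a b} → a ∧ b ≡ false → a ≡ false ⊎ b ≡ false
∧-false {false} _ = inj₁ refl
∧-false {true} eq = inj₂ eq

untouched : ∀ {n} {v i j : Fin n} → v ≢ i → v ≢ j → touch v (i , j) ≡ false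
untouched {v = v} {i} {j} v≢i v≢j rewrite ==-≢ (v≢i ∘ sym) | ==-≢ (v≢j ∘ sym) = refl

separated : ∀ {n} {S : Fin n → Bool} {u v} → S u ≡ false → S v ≡ true → u ≢ v
separated Su Sv refl = contradiction (trans (sym Su) Sv) λ ()

link≤touch : ∀ {n} x (S : Fin n → Bool) e → ⟦ link x S e ⟧ ≤ ⟦ touch x e ⟧
link≤touch x S (i , j) with link x S (i , j) in eq
... | false = z≤n
... | true with link-split S x i j eq
... | inj₁ (_ , refl) rewrite ==-refl i = ≤-refl
... | inj₂ (_ , refl) rewrite ==-refl j | 𝔹.∨-zeroʳ (i == j) = ≤-refl

2+n≤2^n : ∀ n → 2 ≤ n → 2 + n ≤ 2 ^ n
2+n≤2^n (suc (suc n)) (s≤s (s≤s _)) = go n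
  where
  go : ∀ n → 4 + n ≤ 2 ^ (2 + n)
  go zero = ≤-refl
  go (suc n) = ≤-trans (≤-reflexive (+-comm 1 (4 + n)))
    (+-mono-≤ (go n) (≤-trans (≤-trans (s≤s z≤n) (go n)) (m≤m+n (2 ^ (2 + n)) 0)))

⟦⟧-zero : ∀ {b} → ⟦ b ⟧ ≡ 0 → b ≡ false
⟦⟧-zero {false} _ = refl

wt-* : ∀ {A : Set} c w (L : List A) → c * wt w L ≡ wt (λ e → c * w e) L
wt-* c w [] = *-zeroʳ c
wt-* c w (e ∷ L) = trans (*-distribˡ-+ c (w e) (wt w L)) (cong (c * w e +_) (wt-* c w L))

n+n≤2^n : ∀ n → n + n ≤ 2 ^ n
n+n≤2^n 0 = z≤n
n+n≤2^n 1 = ≤-refl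
n+n≤2^n (suc (suc n)) = ≤-trans (≤-trans (≤-reflexive (lem n)) (+-monoˡ-≤ 2 (n+n≤2^n (suc n))))
  (+-monoʳ-≤ (2 ^ suc n) (≤-trans (*-monoʳ-≤ 2 (m^n>0 2 n)) (m≤m+n (2 ^ suc n) 0)))
  where
  lem : ∀ n → 2 + n + (2 + n) ≡ suc n + suc n + 2
  lem = solve-∀

tri-mono : ∀ m a → tri a ≤ tri (m + a)
tri-mono zero a = ≤-refl
tri-mono (suc m) a = ≤-trans (tri-mono m a) (m≤n+m _ (m + a))

-- Among cuts with at least two vertices on each side, the sides induce most edges when one of them
-- has exactly two vertices, which induce the extra 1.
tri-convex : ∀ x y → tri (2 + x) + tri (2 + y) ≤ tri (2 + (x + y)) + 1
tri-convex zero y = ≤-reflexive (+-comm 1 (tri (2 + y)))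
tri-convex (suc x) y = begin
  2 + x + tri (2 + x) + tri (2 + y)          ≡⟨ +-assoc (2 + x) (tri (2 + x)) (tri (2 + y)) ⟩
  2 + x + (tri (2 + x) + tri (2 + y))        ≤⟨ +-mono-≤ (m≤m+n (2 + x) y) (tri-convex x y) ⟩
  2 + (x + y) + (tri (2 + (x + y)) + 1)      ≡⟨ +-assoc (2 + (x + y)) (tri (2 + (x + y))) 1 ⟨
  tri (3 + (x + y)) + 1                      ∎
  where open ≤-Reasoning

∑≤size* : ∀ {n} (S : Fin n → Bool) (f : Fin n → ℕ) c → (∀ i → S i ≡ true → f i ≤ c) →
          sum (λ i → ⟦ S i ⟧ * f i) ≤ size S * c
∑≤size* {zero} S f c le = z≤n
∑≤size* {suc n} S f c le with S zero in eq
... | true = +-mono-≤ (≤-trans (≤-reflexive (+-identityʳ _)) (le zero eq)) (∑≤size* (S ∘ suc) (f ∘ suc) c (le ∘ suc))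
... | false = ∑≤size* (S ∘ suc) (f ∘ suc) c (le ∘ suc)

module Enforcer (n : ℕ) where

  -- S: the vertices not isolated in Avoider's graph; two vertices with the same label are connected in it.
  record Core (A C U : List (Edge n)) : Set where
    field
      S : Fin n → Bool
      lab : Fin n → Fin n
      labels : List (Fin n)
      lab∈ : ∀ v → lab v ∈ labels
      balanced : Balanced C U
      reach : ∀ u v → lab u ≡ lab v → Reach A u v
      single : ∀ u v → S u ≡ false → lab u ≡ lab v → u ≡ v
      paired : ∀ u → S u ≡ true → ∃[ v ] (u ≢ v × lab u ≡ lab v)

    -- The length of `labels` bounds the number of components. A merge by Avoider deletes a label
    -- and so pays for one crossing edge of Enforcer. The start value is n.
    excess : ℕ
    excess = wt (⟦_⟧ ∘ cross lab) C + length labels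

    potential : ℕ
    potential = Φ S C

    same⇒inside : ∀ {i j} → i ≢ j → lab i ≡ lab j → S i ≡ true × S j ≡ true
    same⇒inside {i} {j} i≢j eq with S i in Si | S j in Sj
    ... | true | true = refl , refl
    ... | false | _ = contradiction (single i j Si eq) i≢j
    ... | true | false = contradiction (sym (single j i Sj (sym eq))) i≢j

  open Core

  -- The invariant when Enforcer is to move; Avoider's last edge provides the two non-isolated
  -- vertices.
  Ready : ∀ {A C U} → Core A C U → Set
  Ready c = excess c ≤ n × potential c ≤ n × 2 ≤ size (S c)

  -- The second alternatives hold after Enforcer was forced to connect two labels, respectively to touch an
  -- isolated vertex: then Avoider's next move merges two labels, respectively uses up an isolated vertex.
  record Waiting {A C U} (c : Core A C U) : Set where
    field
      excess≤ : excess c ≤ n ⊎ (excess c ≤ suc n × (∀ e → e ∈ U → cross (lab c) e ≡ true))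
      potential≤ : potential c ≤ n ⊎
        (potential c ≤ n + n × (∀ v → S c v ≡ false → potential c ≤ 2 ^ deg v C + n) ×
         (∀ e → e ∈ U → inside (S c) e ≡ false))

    excess≤suc : excess c ≤ suc n
    excess≤suc = [ m≤n⇒m≤1+n , proj₁ ]′ excess≤

    potential≤2n : potential c ≤ n + n
    potential≤2n = [ (λ le → ≤-trans le (m≤m+n n n)) , proj₁ ]′ potential≤

  open Waiting

  module Merge {A C U} (c : Core A C U) {i j} (p : (i , j) ∈ U) (i≢j : i ≢ j) (labs≢ : lab c i ≢ lab c j) where

    relabel : Fin n → Fin n
    relabel l = if l == lab c j then lab c i else l

    lab′ : Fin n → Fin n
    lab′ v = relabel (lab c v)

    S′ : Fin n → Bool
    S′ = S c ∪ i ∪ j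

    S⊆S′ : ∀ v → S c v ≡ true → S′ v ≡ true
    S⊆S′ v Sv rewrite Sv = refl

    S′-false : ∀ {v} → S′ v ≡ false → S c v ≡ false × v ≢ i × v ≢ j
    S′-false {v} eq with S c v | v ≟ i | v ≟ j
    ... | false | no v≢i | no v≢j = refl , v≢i , v≢j
    S′-false () | true | _ | _
    S′-false () | false | yes _ | _
    S′-false () | false | no _ | yes _

    S′-true : ∀ {v} → S′ v ≡ true → S c v ≡ true ⊎ v ≡ i ⊎ v ≡ j
    S′-true {v} eq with S c v | v ≟ i | v ≟ j
    ... | true | _ | _ = inj₁ refl
    ... | false | yes v≡i | _ = inj₂ (inj₁ v≡i)
    ... | false | no _ | yes v≡j = inj₂ (inj₂ v≡j)
    S′-true () | false | no _ | no _

    S′i : S′ i ≡ true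
    S′i rewrite ==-refl i | 𝔹.∨-zeroʳ (S c i) = refl

    S′j : S′ j ≡ true
    S′j rewrite ==-refl j = 𝔹.∨-zeroʳ _

    labels′ : List (Fin n)
    labels′ = filter (λ l → ¬? (l ≟ lab c j)) (labels c)

    labels< : suc (length labels′) ≤ length (labels c)
    labels< = filter-notAll (λ l → ¬? (l ≟ lab c j)) (labels c) (Any.map (λ eq ≢ → ≢ (sym eq)) (lab∈ c j))

    lab∈′ : ∀ v → lab′ v ∈ labels′
    lab∈′ v with lab c v ≟ lab c j
    ... | yes _ = ∈-filter⁺ (λ l → ¬? (l ≟ lab c j)) (lab∈ c i) labs≢
    ... | no ≢ = ∈-filter⁺ (λ l → ¬? (l ≟ lab c j)) (lab∈ c v) ≢

    lab′-i : lab′ i ≡ lab′ j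
    lab′-i rewrite ==-≢ labs≢ | ==-refl (lab c j) = refl

    reach′ : ∀ u v → lab′ u ≡ lab′ v → Reach ((i , j) ∷ A) u v
    reach′ u v eq with lab c u ≟ lab c j | lab c v ≟ lab c j
    ... | yes uj | yes vj = Reach-∷ (reach c u v (trans uj (sym vj)))
    ... | no _ | no _ = Reach-∷ (reach c u v eq)
    ... | yes uj | no _ = Reach-trans (Reach-∷ (reach c u j uj)) (step (inj₂ (here refl)) (Reach-∷ (reach c i v eq)))
    ... | no _ | yes vj = Reach-trans (Reach-∷ (reach c u i eq)) (step (inj₁ (here refl)) (Reach-∷ (reach c j v (sym vj))))

    single′ : ∀ u v → S′ u ≡ false → lab′ u ≡ lab′ v → u ≡ v
    single′ u v S′u eq with S′-false S′u | lab c u ≟ lab c j | lab c v ≟ lab c j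
    ... | Su , _ , u≢j | yes uj | _ = contradiction (single c u j Su uj) u≢j
    ... | Su , u≢i , _ | no _ | yes _ = contradiction (single c u i Su eq) u≢i
    ... | Su , _ , _ | no _ | no _ = single c u v Su eq

    paired′ : ∀ u → S′ u ≡ true → ∃[ v ] (u ≢ v × lab′ u ≡ lab′ v)
    paired′ u S′u with S′-true S′u
    ... | inj₁ Su = proj₁ (paired c u Su) , proj₁ (proj₂ (paired c u Su)) , cong relabel (proj₂ (proj₂ (paired c u Su)))
    ... | inj₂ (inj₁ refl) = j , i≢j , lab′-i
    ... | inj₂ (inj₂ refl) = i , i≢j ∘ sym , sym lab′-i

    merged : Core ((i , j) ∷ A) ((i , j) ∷ C) (U ─ p)
    merged = record
      { S = S′ ; lab = lab′ ; labels = labels′ ; lab∈ = lab∈′ ; balanced = balanced-─ {C = C} p (balanced c)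
      ; reach = reach′ ; single = single′ ; paired = paired′ }

    cross-mono : ∀ e → ⟦ cross lab′ e ⟧ ≤ ⟦ cross (lab c) e ⟧
    cross-mono (u , v) with lab c u ≟ lab c v
    ... | yes eq rewrite eq | ==-refl (lab′ v) = z≤n
    ... | no _ = ⟦⟧≤1 _

    -- The new edge does not cross under the new labels and a label is lost, so the excess falls
    -- from at most n + 1 to at most n.
    ready : Waiting c → Ready merged
    ready w = s≤s⁻¹ (begin
        suc (excess merged)
          ≡⟨ cong (λ b → suc (⟦ not b ⟧ + wt (⟦_⟧ ∘ cross lab′) C + length labels′)) (trans (cong (_== lab′ j) lab′-i) (==-refl (lab′ j))) ⟩
        suc (wt (⟦_⟧ ∘ cross lab′) C + length labels′)
          ≡⟨ +-suc (wt (⟦_⟧ ∘ cross lab′) C) _ ⟨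
        wt (⟦_⟧ ∘ cross lab′) C + suc (length labels′)
          ≤⟨ +-mono-≤ (wt-mono cross-mono C) labels< ⟩
        excess c
          ≤⟨ excess≤suc w ⟩
        suc n ∎)
      , potential≤n (potential≤ w) , size≥2 S′ i≢j S′i S′j
      where
      open ≤-Reasoning
      mono : ∀ v → ⟦ not (S′ v) ⟧ * 2 ^ deg v ((i , j) ∷ C) ≤ ⟦ not (S c v) ⟧ * 2 ^ deg v C
      mono = Φ-mono {S = S c} {S′} {i , j} {C} S⊆S′ λ v eq → untouched (proj₁ (proj₂ (S′-false eq))) (proj₂ (proj₂ (S′-false eq)))
      -- The isolated endpoint v leaves the sum and takes `2 ^ deg v C` with it, at least the amount
      -- by which the potential exceeds n.
      drop : ∀ v → S c v ≡ false → S′ v ≡ true → potential c ≤ 2 ^ deg v C + n → potential merged ≤ n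
      drop v Sv S′v le = +-cancelˡ-≤ (2 ^ deg v C) _ _ (≤-trans (∑-mono-gap v mono gap) le)
        where
        gap : 2 ^ deg v C + ⟦ not (S′ v) ⟧ * 2 ^ deg v ((i , j) ∷ C) ≤ ⟦ not (S c v) ⟧ * 2 ^ deg v C
        gap rewrite Sv | S′v = ≤-refl
      potential≤n : _ → potential merged ≤ n
      potential≤n (inj₁ le) = ≤-trans (∑-mono mono) le
      potential≤n (inj₂ (_ , le , no-inside)) with ∧-false (no-inside (i , j) p)
      ... | inj₁ Si = drop i Si S′i (le i Si)
      ... | inj₂ Sj = drop j Sj S′j (le j Sj)

  avoiderMove : ∀ {A C U} (c : Core A C U) → Waiting c → ∀ {e} (p : e ∈ U) → ∃ (Ready {e ∷ A} {e ∷ C} {U ─ p})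
  avoiderMove {A} {C} {U} c w {i , j} p with lab c i ≟ lab c j
  ... | no labs≢ = merged , ready w
    where open Merge c p (no-loops {C = C} (balanced c) p) labs≢
  ... | yes eq = c′ , excess′ (excess≤ w) , potential′ (potential≤ w) , size≥2 (S c) i≢j Si Sj
    where
    i≢j = no-loops {C = C} (balanced c) p
    Si = proj₁ (same⇒inside c i≢j eq)
    Sj = proj₂ (same⇒inside c i≢j eq)
    c′ : Core ((i , j) ∷ A) ((i , j) ∷ C) (U ─ p)
    c′ = record
      { S = S c ; lab = lab c ; labels = labels c ; lab∈ = lab∈ c ; balanced = balanced-─ {C = C} p (balanced c)
      ; reach = λ u v eq → Reach-∷ (reach c u v eq) ; single = single c ; paired = paired c }
    same-ij : same (lab c) (i , j) ≡ true
    same-ij = trans (cong (_== lab c j) eq) (==-refl (lab c j))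
    excess′ : _ → excess c′ ≤ n
    excess′ (inj₁ le) = subst (λ b → ⟦ not b ⟧ + wt (⟦_⟧ ∘ cross (lab c)) C + length (labels c) ≤ n) (sym same-ij) le
    -- Avoider's edge lies within a component, whereas in this alternative every free edge crosses.
    excess′ (inj₂ (_ , all-cross)) = contradiction (trans (sym (all-cross (i , j) p)) (cong not same-ij)) λ ()
    potential′ : _ → potential c′ ≤ n
    potential′ (inj₁ le) = ≤-trans (∑-mono (Φ-mono {S = S c} {S c} {i , j} {C} (λ _ → id)
      λ v Sv → untouched (separated {S = S c} Sv Si) (separated {S = S c} Sv Sj))) le
    potential′ (inj₂ (_ , _ , no-inside)) = contradiction (trans (sym (no-inside (i , j) p)) (cong₂ _∧_ Si Sj)) λ ()

  claim : ∀ {A C U} → Core A C U → ∀ {e} (q : e ∈ U) → Core A (e ∷ C) (U ─ q)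
  claim {C = C} c q = record
    { S = S c ; lab = lab c ; labels = labels c ; lab∈ = lab∈ c ; balanced = balanced-─ {C = C} q (balanced c)
    ; reach = reach c ; single = single c ; paired = paired c }

  inside-quiet : ∀ {A C U} (c : Core A C U) {i j} (q : (i , j) ∈ U) → S c i ≡ true → S c j ≡ true →
                 potential (claim c q) ≤ potential c
  inside-quiet {C = C} c {i} {j} q Si Sj = ∑-mono (Φ-mono {S = S c} {S c} {i , j} {C} (λ _ → id)
    λ v Sv → untouched (separated {S = S c} Sv Si) (separated {S = S c} Sv Sj))

  excess-suc : ∀ {A C U} (c : Core A C U) {e} (q : e ∈ U) → excess (claim c q) ≤ suc (excess c)
  excess-suc {C = C} c {e} q = +-monoˡ-≤ (length (labels c)) (+-monoˡ-≤ (wt (⟦_⟧ ∘ cross (lab c)) C) (⟦⟧≤1 (cross (lab c) e)))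

  module Touch {A C U} (c : Core A C U) (rd : Ready c) (no-inside : ∀ e → e ∈ U → inside (S c) e ≡ false)
    (x : Fin n) (Sx : S c x ≡ false) (min : ∀ y → S c y ≡ false → deg x C ≤ deg y C) where

    open ≤-Reasoning

    a m d : ℕ
    a = size (S c)
    m = size (∁ (S c))
    d = deg x C

    -- Otherwise each of the m isolated vertices contributes at least 2^a, which is at least a + 2,
    -- to the potential. Then m(a + 2) is at most n = m + a, impossible for positive m.
    d<a : d < a
    d<a = ≰⇒> λ a≤d → n≮n a (begin
      suc a                   ≡⟨ *-identityˡ (suc a) ⟨
      1 * suc a               ≤⟨ *-monoˡ-≤ (suc a) m≥1 ⟩
      m * suc a               ≤⟨ +-cancelˡ-≤ m _ _ (begin
        m + m * suc a             ≡⟨ *-suc m (suc a) ⟨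
        m * (2 + a)               ≤⟨ *-monoʳ-≤ m (2+n≤2^n a (proj₂ (proj₂ rd))) ⟩
        m * 2 ^ a                 ≤⟨ *-monoʳ-≤ m (^-monoʳ-≤ 2 a≤d) ⟩
        m * 2 ^ d                 ≤⟨ size*≤∑ (∁ (S c)) _ (2 ^ d) (λ y eq → ^-monoʳ-≤ 2 (min y (not-true eq))) ⟩
        potential c               ≤⟨ proj₁ (proj₂ rd) ⟩
        n                         ≡⟨ size-∁ (S c) ⟨
        m + a                     ∎) ⟩
      a                       ∎)
      where
      m≥1 : 1 ≤ m
      m≥1 = ≤-trans (≤-reflexive (cong (⟦_⟧ ∘ not) (sym Sx))) (term≤∑ (⟦_⟧ ∘ ∁ (S c)) x)

    available : 0 < wt (⟦_⟧ ∘ link x (S c)) U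
    available = +-cancelˡ-< (wt (⟦_⟧ ∘ link x (S c)) C) 0 _ (begin-strict
      wt (⟦_⟧ ∘ link x (S c)) C + 0                              ≡⟨ +-identityʳ _ ⟩
      wt (⟦_⟧ ∘ link x (S c)) C                                  ≤⟨ wt-mono (link≤touch x (S c)) C ⟩
      d                                                          <⟨ d<a ⟩
      a                                                          ≡⟨ link-count (S c) x Sx ⟨
      wt (⟦_⟧ ∘ link x (S c)) (allEdges n)                       ≡⟨ balanced c (⟦_⟧ ∘ link x (S c)) ⟨
      wt (⟦_⟧ ∘ link x (S c)) C + wt (⟦_⟧ ∘ link x (S c)) U      ∎)

    link-untouched : ∀ e → link x (S c) e ≡ true → ∀ v → S c v ≡ false → v ≢ x → touch v e ≡ false
    link-untouched (i , j) link-e v Sv v≢x = untouched (separated {S = S c ∪ x} ∪v (proj₁ ends)) (separated {S = S c ∪ x} ∪v (proj₂ ends))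
      where
      ends = ∧-true {(S c ∪ x) i} (link⇒inside x (S c) (i , j) link-e)
      ∪v : (S c ∪ x) v ≡ false
      ∪v rewrite Sv = ==-≢ v≢x

    -- The other end of the edge is not isolated, so only the term of x changes, and it at most
    -- doubles.
    touched : ∃[ e ] Σ (e ∈ U) λ q → potential (claim c q) ≤ 2 ^ d + potential c
    touched with wt-pos (⟦_⟧ ∘ link x (S c)) U available
    ... | e , q , pos = e , q , ∑-mono-bump x others self
      where
      others : ∀ v → v ≢ x → ⟦ not (S c v) ⟧ * 2 ^ deg v (e ∷ C) ≤ ⟦ not (S c v) ⟧ * 2 ^ deg v C
      others v v≢x with S c v in Sv
      ... | true = z≤n
      ... | false rewrite link-untouched e (⟦⟧-pos pos) v Sv v≢x = ≤-refl
      self : ⟦ not (S c x) ⟧ * 2 ^ deg x (e ∷ C) ≤ 2 ^ d + ⟦ not (S c x) ⟧ * 2 ^ d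
      self rewrite Sx = ≤-trans (≤-reflexive (+-identityʳ _)) (^-monoʳ-≤ 2 (+-monoˡ-≤ d (⟦⟧≤1 (touch x e))))

  enforcerMove : ∀ {A C U} (c : Core A C U) → Ready c → 0 < wt one U →
                 ∃[ e ] Σ (e ∈ U) λ q → Σ (Core A (e ∷ C) (U ─ q)) Waiting
  enforcerMove {A} {C} {U} c rd@(excess≤n , potential≤n , _) free with wt (⟦_⟧ ∘ same (lab c)) U in free-same
  ... | suc _ with wt-pos (⟦_⟧ ∘ same (lab c)) U (subst (0 <_) (sym free-same) (s≤s z≤n))
  ... | (i , j) , q , pos = (i , j) , q , claim c q , record
        { excess≤ = inj₁ (subst (λ b → ⟦ not b ⟧ + wt (⟦_⟧ ∘ cross (lab c)) C + length (labels c) ≤ n) (sym (⟦⟧-pos pos)) excess≤n)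
        ; potential≤ = inj₁ (≤-trans (inside-quiet c q (proj₁ ends) (proj₂ ends)) potential≤n) }
    where
    ends = same⇒inside c (no-loops {C = C} (balanced c) q) (==-sound (⟦⟧-pos pos))
  enforcerMove {A} {C} {U} c rd@(excess≤n , potential≤n , _) free | zero with wt (⟦_⟧ ∘ inside (S c)) U in free-inside
  ... | suc _ with wt-pos (⟦_⟧ ∘ inside (S c)) U (subst (0 <_) (sym free-inside) (s≤s z≤n))
  ... | (i , j) , q , pos = (i , j) , q , claim c q , record
        { excess≤ = inj₂ (≤-trans (excess-suc c q) (s≤s excess≤n) , λ e p → not-false (⟦⟧-zero (wt-zero (⟦_⟧ ∘ same (lab c)) free-same (∈-─⇒∈ q p))))
        ; potential≤ = inj₁ (≤-trans (inside-quiet c q (proj₁ ends) (proj₂ ends)) potential≤n) }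
    where
    ends = ∧-true {S c i} (⟦⟧-pos pos)
  enforcerMove {A} {C} {U} c rd@(excess≤n , potential≤n , _) free | zero | zero = e , q , claim c q , record
    { excess≤ = inj₂ (≤-trans (excess-suc c q) (s≤s excess≤n) , λ e p → not-false (⟦⟧-zero (wt-zero (⟦_⟧ ∘ same (lab c)) free-same (∈-─⇒∈ q p))))
    -- The increase 2^d is itself a term of the old potential, whence the bound 2n. As d is least,
    -- whichever isolated vertex Avoider uses up next carries at least that weight.
    ; potential≤ = inj₂ (≤-trans raise (+-mono-≤ (≤-trans (term≤Φ (S c) C x Sx) potential≤n) potential≤n)
                       , (λ v Sv → ≤-trans raise (+-mono-≤ (^-monoʳ-≤ 2 (≤-trans (min v (not-false Sv)) (m≤n+m _ ⟦ touch v e ⟧))) potential≤n))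
                       , λ e p → no-inside e (∈-─⇒∈ q p)) }
    where
    no-inside : ∀ e → e ∈ U → inside (S c) e ≡ false
    no-inside e p = ⟦⟧-zero (wt-zero (⟦_⟧ ∘ inside (S c)) free-inside p)
    isolated : ∃[ x ] ∁ (S c) x ≡ true
    isolated with wt-pos one U free
    ... | (i , j) , p , _ with ∧-false {S c i} (no-inside (i , j) p)
    ... | inj₁ Si = i , not-false Si
    ... | inj₂ Sj = j , not-false Sj
    least = argmin (∁ (S c)) (λ v → deg v C) (proj₁ isolated) (proj₂ isolated)
    x = proj₁ least
    Sx : S c x ≡ false
    Sx = not-true (proj₁ (proj₂ least))
    min = proj₂ (proj₂ least)
    open Touch c rd no-inside x Sx (λ y Sy → min y (not-false Sy))
    e = proj₁ touched
    q = proj₁ (proj₂ touched)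
    raise = proj₂ (proj₂ touched)

  module Outcome {A C U} (c : Core A C U) (w : Waiting c) (n₁ r L : ℕ) (n≡ : n ≡ suc n₁)
    (rounds : wt one C ≡ r + r) (3<L : 3 < L) (n<2^L : n + n < 2 ^ L) (late : tri n₁ + L ≤ r + r) where

    open ≤-Reasoning

    not-early : ¬ (wt one C < tri n₁ + L)
    not-early lt = n≮n (r + r) (<-≤-trans (subst (_< tri n₁ + L) rounds lt) late)

    a m : ℕ
    a = size (S c)
    m = size (∁ (S c))

    degrees : ℕ
    degrees = sum (λ v → ⟦ not (S c v) ⟧ * deg v C)

    outside≤touch : ∀ e → ⟦ outside (S c) e ⟧ ≤ sum (λ v → ⟦ not (S c v) ⟧ * ⟦ touch v e ⟧)
    outside≤touch (i , j) with S c i in Si | S c j in Sj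
    ... | true | true = z≤n
    ... | true | false = ≤-trans (≤-reflexive lem) (term≤∑ (λ v → ⟦ not (S c v) ⟧ * ⟦ touch v (i , j) ⟧) j)
      where
      lem : 1 ≡ ⟦ not (S c j) ⟧ * ⟦ touch j (i , j) ⟧
      lem rewrite Sj | ==-refl j | 𝔹.∨-zeroʳ (i == j) = refl
    ... | false | _ = ≤-trans (≤-reflexive lem) (term≤∑ (λ v → ⟦ not (S c v) ⟧ * ⟦ touch v (i , j) ⟧) i)
      where
      lem : 1 ≡ ⟦ not (S c i) ⟧ * ⟦ touch i (i , j) ⟧
      lem rewrite Si | ==-refl i = refl

    claimed≤ : wt one C ≤ tri a + degrees
    claimed≤ = begin
      wt one C                                                              ≡⟨ wt-cong (inside+outside (S c)) C ⟨
      wt (λ e → ⟦ inside (S c) e ⟧ + ⟦ outside (S c) e ⟧) C                 ≡⟨ wt-+ (⟦_⟧ ∘ inside (S c)) (⟦_⟧ ∘ outside (S c)) C ⟩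
      wt (⟦_⟧ ∘ inside (S c)) C + wt (⟦_⟧ ∘ outside (S c)) C
        ≤⟨ +-mono-≤ (m≤m+n (wt (⟦_⟧ ∘ inside (S c)) C) (wt (⟦_⟧ ∘ inside (S c)) U)) (wt-mono outside≤touch C) ⟩
      wt (⟦_⟧ ∘ inside (S c)) C + wt (⟦_⟧ ∘ inside (S c)) U + wt (λ e → sum (λ v → ⟦ not (S c v) ⟧ * ⟦ touch v e ⟧)) C
        ≡⟨ cong₂ _+_ (trans (balanced c (⟦_⟧ ∘ inside (S c))) (wt-inside (S c)))
                     (trans (sym (wt-∑ (λ v e → ⟦ not (S c v) ⟧ * ⟦ touch v e ⟧) C)) (sum-cong-≗ λ v → sym (wt-* ⟦ not (S c v) ⟧ (⟦_⟧ ∘ touch v) C))) ⟩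
      tri a + degrees ∎

    deg<L : ∀ v → S c v ≡ false → deg v C < L
    deg<L v Sv = ≰⇒> λ L≤ → n≮n (n + n) (begin-strict
      n + n          <⟨ n<2^L ⟩
      2 ^ L          ≤⟨ ^-monoʳ-≤ 2 L≤ ⟩
      2 ^ deg v C    ≤⟨ term≤Φ (S c) C v Sv ⟩
      potential c    ≤⟨ potential≤2n w ⟩
      n + n          ∎)

    -- Termwise, twice a degree is at most 2 to that degree, and the potential is at most 2n.
    degrees≤n : degrees ≤ n
    degrees≤n = ≮⇒≥ λ n< → n≮n (n + n) (begin-strict
      n + n                                                                     <⟨ +-mono-< n< n< ⟩
      degrees + degrees                                                         ≡⟨ ∑-distrib-+ (λ v → ⟦ not (S c v) ⟧ * deg v C) _ ⟨
      sum (λ v → ⟦ not (S c v) ⟧ * deg v C + ⟦ not (S c v) ⟧ * deg v C)         ≤⟨ ∑-mono (λ v → ≤-trans (≤-reflexive (sym (*-distribˡ-+ ⟦ not (S c v) ⟧ (deg v C) _))) (*-monoʳ-≤ ⟦ not (S c v) ⟧ (n+n≤2^n (deg v C)))) ⟩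
      potential c                                                               ≤⟨ potential≤2n w ⟩
      n + n                                                                     ∎)

    -- At most `tri n₁` claimed edges avoid the isolated vertex, and fewer than L touch it.
    one-left : m ≡ 1 → wt one C < tri n₁ + L
    one-left m≡ = begin-strict
      wt one C           ≤⟨ claimed≤ ⟩
      tri a + degrees    <⟨ +-monoʳ-< (tri a) degrees<L ⟩
      tri a + L          ≡⟨ cong (λ z → tri z + L) a≡ ⟩
      tri n₁ + L         ∎
      where
      a≡ : a ≡ n₁
      a≡ = suc-injective (trans (cong (_+ a) (sym m≡)) (trans (size-∁ (S c)) n≡))
      degrees<L : degrees < L
      degrees<L = ≤-trans (s≤s (≤-trans (∑≤size* (∁ (S c)) (λ v → deg v C) (pred L) λ v eq → <⇒≤pred (deg<L v (not-true eq)))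
        (≤-reflexive (trans (cong (_* pred L) m≡) (*-identityˡ _))))) (≤-reflexive (suc-pred L ⦃ >-nonZero (≤-trans (s≤s z≤n) 3<L) ⦄))

    -- With two isolated vertices the inside edges number at most C(n - 2, 2); the n edges allowed
    -- by `degrees≤n` bring the total to `tri n₁ + 2` only.
    two-left : ∀ m₂ → m ≡ 2 + m₂ → wt one C < tri n₁ + L
    two-left m₂ m≡ = begin-strict
      wt one C                              ≤⟨ claimed≤ ⟩
      tri a + degrees                       ≤⟨ +-mono-≤ (tri-mono m₂ a) degrees≤n ⟩
      tri (m₂ + a) + n                      ≡⟨ cong (tri (m₂ + a) +_) (trans n≡ (cong suc n₁≡)) ⟩
      tri (m₂ + a) + (2 + (m₂ + a))         ≡⟨ lem (tri (m₂ + a)) (m₂ + a) ⟩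
      tri (suc (m₂ + a)) + 2                ≡⟨ cong (λ z → tri z + 2) n₁≡ ⟨
      tri n₁ + 2                            <⟨ +-monoʳ-< (tri n₁) (≤-trans (m≤n+m 3 1) 3<L) ⟩
      tri n₁ + L                            ∎
      where
      n₁≡ : n₁ ≡ suc (m₂ + a)
      n₁≡ = suc-injective (trans (sym n≡) (trans (sym (size-∁ (S c))) (cong (_+ a) m≡)))
      lem : ∀ t x → t + (2 + x) ≡ x + t + 2
      lem = solve-∀

    no-isolated : ∀ x → S c x ≡ true
    no-isolated x with S c x in Sx
    ... | true = refl
    ... | false = contradiction small not-early
      where
      small : wt one C < tri n₁ + L
      small with m in m≡
      ... | zero = contradiction (≤-trans (≤-reflexive (cong (⟦_⟧ ∘ not) (sym Sx))) (≤-trans (term≤∑ (⟦_⟧ ∘ ∁ (S c)) x) (≤-reflexive m≡))) λ ()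
      ... | suc zero = one-left m≡
      ... | suc (suc m₂) = two-left m₂ m≡

    module Cut (u v : Fin n) (labs≢ : lab c u ≢ lab c v) where

      Y : Fin n → Bool
      Y z = lab c z == lab c u

      Yv : Y v ≡ false
      Yv = ==-≢ (labs≢ ∘ sym)

      b≥2 : 2 ≤ size Y
      b≥2 with paired c u (no-isolated u)
      ... | u′ , u≢ , eq = size≥2 Y u≢ (==-refl (lab c u)) (trans (cong (_== lab c u) (sym eq)) (==-refl (lab c u)))

      b′≥2 : 2 ≤ size (∁ Y)
      b′≥2 with paired c v (no-isolated v)
      ... | v′ , v≢ , eq = size≥2 (∁ Y) v≢ (not-false Yv) (trans (cong (λ l → not (l == lab c u)) (sym eq)) (not-false Yv))

      cover : ∀ e → one e ≤ ⟦ inside Y e ⟧ + ⟦ inside (∁ Y) e ⟧ + ⟦ cross (lab c) e ⟧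
      cover (i , j) with lab c i ≟ lab c j
      ... | no _ = m≤n+m 1 (⟦ Y i ∧ Y j ⟧ + ⟦ not (Y i) ∧ not (Y j) ⟧)
      ... | yes eq rewrite eq with Y j
      ... | true = ≤-refl
      ... | false = ≤-refl

      sub : ∀ (T : Fin n → Bool) → wt (⟦_⟧ ∘ inside T) C ≤ tri (size T)
      sub T = ≤-trans (m≤m+n _ (wt (⟦_⟧ ∘ inside T) U)) (≤-reflexive (trans (balanced c (⟦_⟧ ∘ inside T)) (wt-inside T)))

      -- The excess is at most n + 1, and at least 1 of it is due to the label list.
      crossing≤n : wt (⟦_⟧ ∘ cross (lab c)) C ≤ n
      crossing≤n = s≤s⁻¹ (begin
        suc (wt (⟦_⟧ ∘ cross (lab c)) C)                       ≡⟨ +-comm 1 _ ⟩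
        wt (⟦_⟧ ∘ cross (lab c)) C + 1                         ≤⟨ +-monoʳ-≤ (wt (⟦_⟧ ∘ cross (lab c)) C) (nonempty (lab∈ c u)) ⟩
        excess c                                               ≤⟨ excess≤suc w ⟩
        suc n                                                  ∎)
        where
        nonempty : ∀ {l} {ls : List (Fin n)} → l ∈ ls → 1 ≤ length ls
        nonempty (here _) = s≤s z≤n
        nonempty (there _) = s≤s z≤n

      -- By `tri-convex` the two sides hold at most C(n - 2, 2) + 1 edges; n crossing edges more
      -- give `tri n₁ + 3`, which accounts for the hypothesis `3<L`.
      claimed-cut : wt one C < tri n₁ + L
      claimed-cut with m≤n⇒∃[o]m+o≡n b≥2 | m≤n⇒∃[o]m+o≡n b′≥2
      ... | x , x≡ | y , y≡ = begin-strict
        wt one C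
          ≤⟨ wt-mono cover C ⟩
        wt (λ e → ⟦ inside Y e ⟧ + ⟦ inside (∁ Y) e ⟧ + ⟦ cross (lab c) e ⟧) C
          ≡⟨ trans (wt-+ (λ e → ⟦ inside Y e ⟧ + ⟦ inside (∁ Y) e ⟧) (⟦_⟧ ∘ cross (lab c)) C)
                   (cong (_+ wt (⟦_⟧ ∘ cross (lab c)) C) (wt-+ (⟦_⟧ ∘ inside Y) (⟦_⟧ ∘ inside (∁ Y)) C)) ⟩
        wt (⟦_⟧ ∘ inside Y) C + wt (⟦_⟧ ∘ inside (∁ Y)) C + wt (⟦_⟧ ∘ cross (lab c)) C
          ≤⟨ +-mono-≤ (+-mono-≤ (sub Y) (sub (∁ Y))) crossing≤n ⟩
        tri (size Y) + tri (size (∁ Y)) + n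
          ≡⟨ cong₂ (λ p q → tri p + tri q + n) x≡ y≡ ⟨
        tri (2 + x) + tri (2 + y) + n
          ≤⟨ +-monoˡ-≤ n (tri-convex x y) ⟩
        tri (2 + (x + y)) + 1 + n
          ≡⟨ cong (tri (2 + (x + y)) + 1 +_) (trans n≡ (cong suc n₁≡)) ⟩
        tri (2 + (x + y)) + 1 + (4 + (x + y))
          ≡⟨ lem (tri (2 + (x + y))) (x + y) ⟩
        tri (3 + (x + y)) + 3
          ≡⟨ cong (λ z → tri z + 3) n₁≡ ⟨
        tri n₁ + 3
          <⟨ +-monoʳ-< (tri n₁) 3<L ⟩
        tri n₁ + L ∎
        where
        lem : ∀ t z → t + 1 + (4 + z) ≡ 2 + z + t + 3
        lem = solve-∀
        lem′ : ∀ x y → 2 + y + (2 + x) ≡ suc (3 + (x + y))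
        lem′ = solve-∀
        n₁≡ : n₁ ≡ 3 + (x + y)
        n₁≡ = suc-injective (trans (sym n≡) (trans (sym (size-∁ Y)) (trans (cong₂ _+_ (sym y≡) (sym x≡)) (lem′ x y))))

    connected : 𝒯 n A
    connected u v with lab c u ≟ lab c v
    ... | yes eq = reach c u v eq
    ... | no labs≢ = contradiction (Cut.claimed-cut u v labs≢) not-early

  module _ (n₁ L : ℕ) (n≡ : n ≡ suc n₁) (3<L : 3 < L) (n<2^L : n + n < 2 ^ L) where

    -- The last bound guarantees two free edges in every round, so both players can move. Avoider's
    -- graph is inspected only after the last round, where `Outcome` applies.
    wins : ∀ s {A C U} (c : Core A C U) → Waiting c → ∀ r → wt one C ≡ r + r →
           tri n₁ + L ≤ (r + s) + (r + s) → (r + s) + (r + s) ≤ tri n → EnforcerWithin (𝒯 n) s A U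
    wins zero {A} c w r rounds late _ = A , id ,
      Outcome.connected c w n₁ r L n≡ rounds 3<L n<2^L (subst (λ z → tri n₁ + L ≤ z + z) (+-identityʳ r) late)
    wins (suc s) {A} {C} {U} c w r rounds late room = inj₂ (nonempty , turn)
      where
      free : 2 ≤ wt one U
      free = +-cancelˡ-≤ (r + r) _ _ (begin
        r + r + 2                        ≤⟨ m≤m+n (r + r + 2) (s + s) ⟩
        r + r + 2 + (s + s)              ≡⟨ lem r s ⟩
        r + suc s + (r + suc s)          ≤⟨ room ⟩
        tri n                            ≡⟨ wt-one n ⟨
        wt one (allEdges n)              ≡⟨ balanced c one ⟨
        wt one C + wt one U              ≡⟨ cong (_+ wt one U) rounds ⟩
        r + r + wt one U                 ∎)
        where
        open ≤-Reasoning
        lem : ∀ r s → r + r + 2 + (s + s) ≡ r + suc s + (r + suc s)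
        lem = solve-∀
      nonempty : ∃[ e ] e ∈ U
      nonempty with wt-pos one U (≤-trans (s≤s z≤n) free)
      ... | e , p , _ = e , p
      turn : ∀ e (p : e ∈ U) → Lost (𝒯 n) (e ∷ A) ⊎
             (∃[ e′ ] Σ (e′ ∈ (U ─ p)) λ q → EnforcerWithin (𝒯 n) s (e ∷ A) ((U ─ p) ─ q))
      turn e p with avoiderMove c w p
      ... | c₁ , ready with enforcerMove c₁ ready (s≤s⁻¹ (≤-trans free (≤-reflexive (sym (wt-─ one p)))))
      ... | e′ , q , c₂ , w₂ = inj₂ (e′ , q , wins s c₂ w₂ (suc r)
              (trans (cong (2 +_) rounds) (cong suc (sym (+-suc r r))))
              (subst (λ z → tri n₁ + L ≤ z + z) (+-suc r s) late) (subst (λ z → z + z ≤ tri n) (+-suc r s) room))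

    initial : Core [] [] (allEdges n)
    initial = record
      { S = λ _ → false ; lab = id ; labels = allFin n ; lab∈ = ∈-allFin ; balanced = λ _ → refl
      ; reach = λ { u .u refl → here } ; single = λ _ _ _ → id ; paired = λ _ () }

    initial-waiting : Waiting initial
    initial-waiting = record
      { excess≤ = inj₁ (≤-reflexive (length-tabulate {n = n} id))
      ; potential≤ = inj₁ (≤-reflexive (∑-one n)) }

    within : ∀ t → tri n₁ + L ≤ t + t → t + t ≤ tri n → EnforcerWithin (𝒯 n) t [] (allEdges n)
    within t = wins t initial initial-waiting 0 refl

-- Decidability and the logarithmic window

Adj-⊆ : ∀ {n} {H A : List (Edge n)} → H ⊆ A → ∀ {u v} → Adj H u v → Adj A u v
Adj-⊆ H⊆A = ⊎-map H⊆A H⊆A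

Reach-⊆ : ∀ {n} {H A : List (Edge n)} → H ⊆ A → ∀ {u v} → Reach H u v → Reach A u v
Reach-⊆ H⊆A here = here
Reach-⊆ H⊆A (step a r) = step (Adj-⊆ H⊆A a) (Reach-⊆ H⊆A r)

Monotone : ∀ {n} → Hypergraph n → Set
Monotone F = ∀ {H A} → H ⊆ A → F H → F A

𝒟-monotone : ∀ n → Monotone (𝒟 n)
𝒟-monotone n H⊆A dom v = proj₁ (dom v) , Adj-⊆ H⊆A (proj₂ (dom v))

𝒯-monotone : ∀ n → Monotone (𝒯 n)
𝒯-monotone n H⊆A conn u v = Reach-⊆ H⊆A (conn u v)

-- A walk can be shortened so as to use the new edge at most once, in one direction. This reduces
-- reachability to a shorter edge list.
Reach-via : ∀ {n} {H : List (Edge n)} {a b u v} → Reach ((a , b) ∷ H) u v →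
  Reach H u v ⊎ (Reach H u a × Reach H b v) ⊎ (Reach H u b × Reach H a v)
Reach-via here = inj₁ here
Reach-via (step adj r) with adj | Reach-via r
... | inj₁ (here refl) | inj₁ bv = inj₂ (inj₁ (here , bv))
... | inj₁ (here refl) | inj₂ (inj₁ (_ , bv)) = inj₂ (inj₁ (here , bv))
... | inj₁ (here refl) | inj₂ (inj₂ (_ , av)) = inj₁ av
... | inj₂ (here refl) | inj₁ av = inj₂ (inj₂ (here , av))
... | inj₂ (here refl) | inj₂ (inj₁ (_ , bv)) = inj₁ bv
... | inj₂ (here refl) | inj₂ (inj₂ (_ , av)) = inj₂ (inj₂ (here , av))
... | inj₁ (there p) | inj₁ wv = inj₁ (step (inj₁ p) wv)
... | inj₁ (there p) | inj₂ (inj₁ (wa , bv)) = inj₂ (inj₁ (step (inj₁ p) wa , bv))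
... | inj₁ (there p) | inj₂ (inj₂ (wb , av)) = inj₂ (inj₂ (step (inj₁ p) wb , av))
... | inj₂ (there p) | inj₁ wv = inj₁ (step (inj₂ p) wv)
... | inj₂ (there p) | inj₂ (inj₁ (wa , bv)) = inj₂ (inj₁ (step (inj₂ p) wa , bv))
... | inj₂ (there p) | inj₂ (inj₂ (wb , av)) = inj₂ (inj₂ (step (inj₂ p) wb , av))

Reach? : ∀ {n} (H : List (Edge n)) u v → Dec (Reach H u v)
Reach? [] u v = map′ (λ { refl → here }) (λ { here → refl ; (step (inj₁ ()) _) ; (step (inj₂ ()) _) }) (u ≟ v)
Reach? ((a , b) ∷ H) u v = map′ join Reach-via
  (Reach? H u v ⊎-dec ((Reach? H u a ×-dec Reach? H b v) ⊎-dec (Reach? H u b ×-dec Reach? H a v)))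
  where
  join : _ → Reach ((a , b) ∷ H) u v
  join (inj₁ uv) = Reach-∷ uv
  join (inj₂ (inj₁ (ua , bv))) = Reach-trans (Reach-∷ ua) (step (inj₁ (here refl)) (Reach-∷ bv))
  join (inj₂ (inj₂ (ub , av))) = Reach-trans (Reach-∷ ub) (step (inj₂ (here refl)) (Reach-∷ av))

𝒟? : ∀ n H → Dec (𝒟 n H)
𝒟? n H = all? λ v → any? λ u → ((v , u) ∈? H) ⊎-dec ((u , v) ∈? H)
  where open DecMembership (≡-dec (_≟_ {n}) (_≟_ {n})) using (_∈?_)

𝒯? : ∀ n H → Dec (𝒯 n H)
𝒯? n H = all? λ u → all? λ v → Reach? H u v

-- By monotonicity Avoider's whole edge set may serve as the hyperedge, so no search through subsets
-- is made.
Lost? : ∀ {n} (F : Hypergraph n) → Monotone F → (∀ H → Dec (F H)) → ∀ A → Dec (Lost F A)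
Lost? F mono F? A = map′ (λ FA → A , id , FA) (λ (H , H⊆A , FH) → mono H⊆A FH) (F? A)

all∈? : ∀ {A : Set} (U : List A) {P : ∀ e → e ∈ U → Set} → (∀ e p → Dec (P e p)) → Dec (∀ e p → P e p)
all∈? [] P? = yes λ _ ()
all∈? (e ∷ U) P? = map′ (λ { (h , t) _ (here refl) → h ; (h , t) e′ (there p) → t e′ p })
  (λ f → f e (here refl) , λ e′ p → f e′ (there p)) (P? e (here refl) ×-dec all∈? U λ e′ p → P? e′ (there p))

any∈? : ∀ {A : Set} (U : List A) {P : ∀ e → e ∈ U → Set} → (∀ e p → Dec (P e p)) → Dec (∃[ e ] Σ (e ∈ U) (P e))
any∈? [] P? = no λ ()
any∈? (e ∷ U) P? = map′ (λ { (inj₁ h) → e , here refl , h ; (inj₂ (e′ , p , h)) → e′ , there p , h })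
  (λ { (_ , here refl , h) → inj₁ h ; (e′ , there p , h) → inj₂ (e′ , p , h) }) (P? e (here refl) ⊎-dec any∈? U λ e′ p → P? e′ (there p))

nonempty? : ∀ {A : Set} (U : List A) → Dec (∃[ e ] e ∈ U)
nonempty? [] = no λ ()
nonempty? (e ∷ U) = yes (e , here refl)

-- Decidability turns the existence of some winning time into the existence of a least one, as
-- `IsTauE` demands.
EnforcerWithin? : ∀ {n} (F : Hypergraph n) → (∀ A → Dec (Lost F A)) → ∀ t A U → Dec (EnforcerWithin F t A U)
EnforcerWithin? F lost? zero A U = lost? A
EnforcerWithin? F lost? (suc t) A U = lost? A ⊎-dec (nonempty? U ×-dec all∈? U λ e p →
  lost? (e ∷ A) ⊎-dec any∈? (U ─ p) λ e′ q → EnforcerWithin? F lost? t (e ∷ A) ((U ─ p) ─ q))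

EnforcerWithin-map : ∀ {n} {F G : Hypergraph n} → (∀ H → F H → G H) → ∀ t A U → EnforcerWithin F t A U → EnforcerWithin G t A U
EnforcerWithin-map {F = F} {G} f = go
  where
  lost : ∀ {A} → Lost F A → Lost G A
  lost (H , H⊆A , FH) = H , H⊆A , f H FH
  go : ∀ t A U → EnforcerWithin F t A U → EnforcerWithin G t A U
  go zero A U l = lost l
  go (suc t) A U (inj₁ l) = inj₁ (lost l)
  go (suc t) A U (inj₂ (ne , reply)) = inj₂ (ne , λ e p → ⊎-map lost (λ (e′ , q , W) → e′ , q , go t _ _ W) (reply e p))

𝒯⇒𝒟 : ∀ n H → 𝒯 (2 + n) H → 𝒟 (2 + n) H
𝒯⇒𝒟 n H conn v = first (proj₂ (other v)) (conn v (proj₁ (other v)))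
  where
  other : (v : Fin (2 + n)) → ∃[ u ] v ≢ u
  other zero = suc zero , λ ()
  other (suc v) = zero , λ ()
  first : ∀ {v u} → v ≢ u → Reach H v u → ∃[ w ] Adj H v w
  first v≢u here = contradiction refl v≢u
  first v≢u (step adj _) = _ , adj

least : ∀ {P : ℕ → Set} → (∀ t → Dec (P t)) → ∀ t → P t → ∃[ m ] (P m × (∀ s → P s → m ≤ s))
least P? t Pt with P? 0
least P? t Pt | yes P0 = 0 , P0 , λ _ _ → z≤n
least P? zero Pt | no ¬P0 = contradiction Pt ¬P0
least P? (suc t) Pt | no ¬P0 with least (P? ∘ suc) t Pt
... | m , Pm , min = suc m , Pm , λ { zero P0 → contradiction P0 ¬P0 ; (suc s) Ps → s≤s (min s Ps) }

size-prefix : ∀ n a → a ≤ n → size {n} (λ i → toℕ i <ᵇ a) ≡ a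
size-prefix zero zero _ = refl
size-prefix (suc n) zero _ = ∑-zero n
size-prefix (suc n) (suc a) (s≤s a≤n) = cong suc (size-prefix n a a≤n)

lower-bound : ∀ n k → 0 < k → k + 4 * k * 2 ^ (8 * k) ≤ suc n → ∀ s → EnforcerWithin (𝒟 (suc n)) s [] (allEdges (suc n)) →
        tri n + k ≤ s + s
lower-bound n k 0<k room s W with m≤n⇒∃[o]m+o≡n room
... | o , o≡ = Avoider.lasts n k s {C = []} {r = 0} record
    { S = S ; m = M₁ ; size-S = trans (cong (_+ M₁) size-S) size+ ; k≤size = subst (k ≤_) (sym size-S) (m≤m+n k o)
    ; balanced = λ _ → refl ; rounds = refl ; avoids = λ _ () ; μ = 0 ; μ≤ = λ _ _ → z≤n
    ; quota = λ D _ ev → quota-start k 0<k M₁ M₁≡ (size S) D ev } W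
  where
  B = 4 * k * 2 ^ (8 * k)
  M₁ = pred B
  M₁≡ : suc M₁ ≡ B
  M₁≡ = suc-pred B ⦃ m*n≢0 (4 * k) (2 ^ (8 * k)) ⦃ m*n≢0 4 k ⦃ _ ⦄ ⦃ >-nonZero 0<k ⦄ ⦄ ⦃ m^n≢0 2 (8 * k) ⦄ ⦄
  S : Fin (suc n) → Bool
  -- All vertices except the last B, the number from which `quota-start` halves.
  S i = toℕ i <ᵇ k + o
  lem : ∀ k o b → suc (k + o + b) ≡ k + suc b + o
  lem = solve-∀
  size+ : k + o + M₁ ≡ n
  size+ = suc-injective (trans (lem k o M₁) (trans (cong (λ b → k + b + o) M₁≡) o≡))
  size-S : size S ≡ k + o
  size-S = size-prefix (suc n) (k + o) (≤-trans (m≤m+n (k + o) M₁) (≤-trans (≤-reflexive size+) (n≤1+n n)))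

log₂-bounds : ∀ n → 0 < n → ∃[ ℓ ] (2 ^ ℓ ≤ n × n < 2 ^ suc ℓ)
log₂-bounds (suc zero) _ = 0 , ≤-refl , ≤-refl
log₂-bounds (suc (suc n)) _ with log₂-bounds (suc n) (s≤s z≤n)
... | ℓ , lo , hi with m≤n⇒m<n∨m≡n hi
... | inj₁ lt = ℓ , m≤n⇒m≤1+n lo , lt
... | inj₂ eq = suc ℓ , ≤-reflexive (sym eq) , subst (_< 2 ^ (2 + ℓ)) (sym eq) (^-monoʳ-< 2 ≤-refl (n<1+n (suc ℓ)))

half-up : ∀ x → ∃[ t ] (x ≤ t + t × t + t ≤ suc x)
half-up 0 = 0 , z≤n , z≤n
half-up 1 = 1 , s≤s z≤n , ≤-refl
half-up (suc (suc x)) with half-up x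
... | t , lo , hi = suc t , subst (2 + x ≤_) (cong suc (sym (+-suc t t))) (s≤s (s≤s lo)) , subst (_≤ 3 + x) (cong suc (sym (+-suc t t))) (s≤s (s≤s hi))

-- With ℓ = ⌊log₂ n⌋ the lower bound is proved with k = ⌊ℓ/12⌋, the upper one with L = ℓ + 2.
module Window (n₂ ℓ : ℕ) (12≤ℓ : 12 ≤ ℓ) (2^ℓ≤n : 2 ^ ℓ ≤ 2 + n₂) (n<2^ : 2 + n₂ < 2 ^ suc ℓ) where

  open ≤-Reasoning

  n n₁ k L : ℕ
  n = 2 + n₂
  n₁ = 1 + n₂
  k = ℓ / 12
  L = 2 + ℓ

  12k≤ℓ : k * 12 ≤ ℓ
  12k≤ℓ = subst (k * 12 ≤_) (sym (m≡m%n+[m/n]*n ℓ 12)) (m≤n+m _ (ℓ % 12))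

  ℓ<12k+12 : ℓ < 12 + k * 12
  ℓ<12k+12 = subst (_< 12 + k * 12) (sym (m≡m%n+[m/n]*n ℓ 12)) (+-monoˡ-< (k * 12) (m%n<n ℓ 12))

  0<k : 0 < k
  0<k = ≰⇒> λ { k≤0 → n≮n 12 (<-≤-trans (≤-<-trans 12≤ℓ ℓ<12k+12) (+-monoʳ-≤ 12 (*-monoˡ-≤ 12 k≤0))) }

  suc-ℓ≤ : suc ℓ ≤ 24 * k
  suc-ℓ≤ = ≤-trans ℓ<12k+12 (≤-trans (+-monoˡ-≤ (k * 12) (*-monoʳ-≤ 12 0<k)) (≤-reflexive (lem k)))
    where
    lem : ∀ k → 12 * k + k * 12 ≡ 24 * k
    lem = solve-∀

  -- This fixes the divisor 12: the left side is at most 2^(3 + 9k), hence at most 2^(12k) because k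
  -- is positive.
  room : k + 4 * k * 2 ^ (8 * k) ≤ n
  room = begin
    k + 4 * k * 2 ^ (8 * k)                ≤⟨ +-monoˡ-≤ (4 * k * 2 ^ (8 * k)) (m≤m*n k (2 ^ (8 * k)) ⦃ m^n≢0 2 (8 * k) ⦄) ⟩
    k * 2 ^ (8 * k) + 4 * k * 2 ^ (8 * k)  ≡⟨ lem k (2 ^ (8 * k)) ⟩
    5 * k * 2 ^ (8 * k)                    ≤⟨ *-monoˡ-≤ (2 ^ (8 * k)) (*-mono-≤ (m≤m+n 5 3) (≤-trans (m≤m+n k k) (n+n≤2^n k))) ⟩
    2 ^ 3 * 2 ^ k * 2 ^ (8 * k)            ≡⟨ cong (_* 2 ^ (8 * k)) (^-distribˡ-+-* 2 3 k) ⟨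
    2 ^ (3 + k) * 2 ^ (8 * k)              ≡⟨ ^-distribˡ-+-* 2 (3 + k) (8 * k) ⟨
    2 ^ (3 + k + 8 * k)                    ≤⟨ ^-monoʳ-≤ 2 (≤-trans (+-monoˡ-≤ (8 * k) (+-monoˡ-≤ k (*-monoʳ-≤ 3 0<k))) (≤-trans (≤-reflexive (lem′ k)) 12k≤ℓ)) ⟩
    2 ^ ℓ                                  ≤⟨ 2^ℓ≤n ⟩
    n                                      ∎
    where
    lem : ∀ k x → k * x + 4 * k * x ≡ 5 * k * x
    lem = solve-∀
    lem′ : ∀ k → 3 * k + k + 8 * k ≡ k * 12
    lem′ = solve-∀

  -- The potential may reach 2n right after a forced move of Enforcer; this costs one more than the
  -- `ℓ + 1` that suffices for n.
  n+n<2^L : n + n < 2 ^ L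
  n+n<2^L = ≤-trans (+-mono-< n<2^ n<2^) (≤-reflexive (cong (2 ^ suc ℓ +_) (sym (+-identityʳ _))))

  goal : ℕ
  goal = proj₁ (half-up (tri n₁ + L))

  goal-lo : tri n₁ + L ≤ goal + goal
  goal-lo = proj₁ (proj₂ (half-up (tri n₁ + L)))

  goal-hi : goal + goal ≤ suc (tri n₁ + L)
  goal-hi = proj₂ (proj₂ (half-up (tri n₁ + L)))

  won : EnforcerWithin (𝒯 n) goal [] (allEdges n)
  won = Enforcer.within n n₁ L refl (≤-trans (m≤n+m 4 10) (+-monoʳ-≤ 2 12≤ℓ)) n+n<2^L goal goal-lo (begin
    goal + goal               ≤⟨ goal-hi ⟩
    suc (tri n₁ + L)          ≡⟨ +-suc (tri n₁) L ⟨
    tri n₁ + suc L            ≤⟨ +-monoʳ-≤ (tri n₁) L<n₁ ⟩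
    tri n₁ + n₁               ≡⟨ +-comm (tri n₁) n₁ ⟩
    tri n                     ∎)
    where
    L<n₁ : suc L ≤ n₁
    L<n₁ = s≤s⁻¹ (begin
      4 + ℓ      ≤⟨ +-monoˡ-≤ ℓ (≤-trans (m≤m+n 4 8) 12≤ℓ) ⟩
      ℓ + ℓ      ≤⟨ n+n≤2^n ℓ ⟩
      2 ^ ℓ      ≤⟨ 2^ℓ≤n ⟩
      n          ∎)

  -- Any F between the two hypergraphs inherits the upper bound from `𝒯` and the lower bound from
  -- `𝒟`, so both cases are treated at once.
  between : (F : Hypergraph n) → Monotone F → (∀ H → Dec (F H)) → (∀ H → 𝒯 n H → F H) → (∀ H → F H → 𝒟 n H) →
            TauBetween n F 1 48 1 1
  between F mono F? 𝒯⇒F F⇒𝒟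
    with least (λ t → EnforcerWithin? F (Lost? F mono F?) t [] (allEdges n)) goal (EnforcerWithin-map 𝒯⇒F goal [] (allEdges n) won)
  ... | t , W , min = t , (W , min) , subst (λ c → (c ≤ 2 * t) × (n ^ 2 ≤ 2 ^ (48 * (2 * t ∸ c)))) (sym (tri≡C2 n₁)) (tri≤ , below)
        , subst (λ c → 2 ^ (1 * (2 * t ∸ c)) ≤ n ^ 2) (sym (tri≡C2 n₁)) above
    where
    2t≡ : 2 * t ≡ t + t
    2t≡ = cong (t +_) (+-identityʳ t)
    tri+k≤ : tri n₁ + k ≤ 2 * t
    tri+k≤ = subst (tri n₁ + k ≤_) (sym 2t≡) (lower-bound n₁ k 0<k room t (EnforcerWithin-map F⇒𝒟 t [] (allEdges n) W))
    tri≤ : tri n₁ ≤ 2 * t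
    tri≤ = ≤-trans (m≤m+n (tri n₁) k) tri+k≤
    k≤gap : k ≤ 2 * t ∸ tri n₁
    k≤gap = m+n≤o⇒m≤o∸n k (subst (_≤ 2 * t) (+-comm (tri n₁) k) tri+k≤)
    gap≤ : 2 * t ∸ tri n₁ ≤ suc L
    gap≤ = m≤n+o⇒m∸n≤o (2 * t) (tri n₁) (begin
      2 * t               ≡⟨ 2t≡ ⟩
      t + t               ≤⟨ +-mono-≤ t≤goal t≤goal ⟩
      goal + goal         ≤⟨ goal-hi ⟩
      suc (tri n₁ + L)    ≡⟨ +-suc (tri n₁) L ⟨
      tri n₁ + suc L      ∎)
      where
      t≤goal : t ≤ goal
      t≤goal = min goal (EnforcerWithin-map 𝒯⇒F goal [] (allEdges n) won)
    below : n ^ 2 ≤ 2 ^ (48 * (2 * t ∸ tri n₁))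
    below = begin
      n ^ 2                              ≤⟨ ^-monoˡ-≤ 2 (<⇒≤ n<2^) ⟩
      (2 ^ suc ℓ) ^ 2                    ≡⟨ ^-*-assoc 2 (suc ℓ) 2 ⟩
      2 ^ (suc ℓ * 2)                    ≤⟨ ^-monoʳ-≤ 2 (*-monoˡ-≤ 2 suc-ℓ≤) ⟩
      2 ^ (24 * k * 2)                   ≡⟨ cong (2 ^_) (lem k) ⟩
      2 ^ (48 * k)                       ≤⟨ ^-monoʳ-≤ 2 (*-monoʳ-≤ 48 k≤gap) ⟩
      2 ^ (48 * (2 * t ∸ tri n₁))        ∎
      where
      lem : ∀ k → 24 * k * 2 ≡ 48 * k
      lem = solve-∀
    above : 2 ^ (1 * (2 * t ∸ tri n₁)) ≤ n ^ 2
    above = begin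
      2 ^ (1 * (2 * t ∸ tri n₁))         ≡⟨ cong (2 ^_) (*-identityˡ (2 * t ∸ tri n₁)) ⟩
      -- The gap is at most `ℓ + 3`, counting one for rounding `goal` up, and this is at most 2ℓ.
      2 ^ (2 * t ∸ tri n₁)               ≤⟨ ^-monoʳ-≤ 2 (≤-trans gap≤ (+-monoˡ-≤ ℓ (≤-trans (m≤m+n 3 9) 12≤ℓ))) ⟩
      2 ^ (ℓ + ℓ)                        ≡⟨ cong (2 ^_) (lem ℓ) ⟩
      2 ^ (ℓ * 2)                        ≡⟨ ^-*-assoc 2 ℓ 2 ⟨
      (2 ^ ℓ) ^ 2                        ≤⟨ ^-monoˡ-≤ 2 2^ℓ≤n ⟩
      n ^ 2                              ∎
      where
      lem : ∀ ℓ → ℓ + ℓ ≡ ℓ * 2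
      lem = solve-∀

theorem3 : ∃[ p₁ ] ∃[ q₁ ] ∃[ p₂ ] ∃[ q₂ ]
    (1 ≤ p₁ × 1 ≤ q₁ × 1 ≤ p₂ × 1 ≤ q₂ ×
    ∃[ N ] (∀ (n : ℕ) → N ≤ n →
    TauBetween n (𝒟 n) p₁ q₁ p₂ q₂ × TauBetween n (𝒯 n) p₁ q₁ p₂ q₂))
-- The factor 48 is twice the 24 of `suc-ℓ≤`, the gap being measured in half rounds. From 2^12 on, ℓ
-- is at least 12 and k is positive. Passing from base 2 to natural logarithms only rescales the
-- constants.
theorem3 = 1 , 48 , 1 , 1 , s≤s z≤n , s≤s z≤n , s≤s z≤n , s≤s z≤n , 2 ^ 12 , bounds
  where
  bounds : ∀ n → 2 ^ 12 ≤ n → TauBetween n (𝒟 n) 1 48 1 1 × TauBetween n (𝒯 n) 1 48 1 1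
  bounds zero le = contradiction le λ ()
  bounds (suc zero) le = contradiction le λ { (s≤s ()) }
  bounds n@(suc (suc n₂)) le with log₂-bounds n (s≤s z≤n)
  ... | ℓ , lo , hi = between (𝒟 n) (𝒟-monotone n) (𝒟? n) (𝒯⇒𝒟 n₂) (λ _ → id)
                    , between (𝒯 n) (𝒯-monotone n) (𝒯? n) (λ _ → id) (𝒯⇒𝒟 n₂)
    where
    12≤ℓ : 12 ≤ ℓ
    12≤ℓ = s≤s⁻¹ (≰⇒> λ ℓ<12 → n≮n n (<-≤-trans hi (≤-trans (^-monoʳ-≤ 2 ℓ<12) le)))
    open Window n₂ ℓ 12≤ℓ lo hi using (between)
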